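{- (In ZFC.) Let $r\geq3$ be an integer, $\kappa>0$ a cardinal, $\tau>0$ an ordinal, and $\lambda_\xi\geq r+1$ cardinals for $\xi<\tau$. If $\kappa\nrightarrow(\lambda_\xi)^r_{\xi<\tau}$, then \[ 2^\kappa\nrightarrow\big((\lambda_\xi+1)_{\xi<\tau},\underbrace{r+2,\dots,r+2}_{\eta(r)\text{ terms}}\big)^{r+1}, \] i.e. there is a colouring $g:\binom{2^\kappa}{r+1}\to\tau\oplus\eta(r)$ such that for no $\xi<\tau$ is there a set of cardinality $\lambda_\xi+1$ (cardinal addition) monochromatic in colour $\xi$, and for no $j<\eta(r)$ is there a set of cardinality $r+2$ monochromatic in colour $\tau\oplus j$. Here $\eta(r)=1$ if $r=3$, $\eta(r)=2$ if $r>3$ is even, $\eta(r)=3$ if $r>3$ is odd.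
   Context: Von Neumann ordinals are used; $\oplus$ denotes ordinal addition, $+$ cardinal addition, and $\binom{A}{r}$ the set of $r$-element subsets of $A$. For an integer $r\geq2$, an ordinal $\tau>0$, a cardinal $\kappa>0$ and cardinals $\lambda_\xi\geq r+1$ ($\xi<\tau$): a set $X\subset\kappa$ is monochromatic in colour $\xi$ under $f:\binom{\kappa}{r}\to\tau$ if $f(T)=\xi$ for all $T\in\binom{X}{r}$; $\kappa\nrightarrow(\lambda_\xi)^r_{\xi<\tau}$ means there is some $f:\binom{\kappa}{r}\to\tau$ such that there is no $\xi<\tau$ and $X\subset\kappa$ monochromatic in colour $\xi$ with $|X|=\lambda_\xi$. -}

module Defs where

open import Data.Bool.Base using (if_then_else_)
open import Data.Fin.Base as Fin using (Fin)
open import Data.Fin.Induction using () renaming (<-wellFounded to Fin-<-wellFounded)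
open import Data.Fin.Properties using () renaming (<-isStrictTotalOrder to Fin-<-isStrictTotalOrder)
open import Data.Nat.Base using (ℕ)
open import Data.Nat.Divisibility using (_∣?_)
open import Data.Nat.Properties using (_≟_)
open import Data.Product.Base using (∃; _×_; proj₁; _,_; Σ-syntax; ∃-syntax)
open import Data.Sum.Base using (_⊎_)
open import Data.Sum.Relation.Binary.LeftOrder
  using (_⊎-<_; ⊎-<-isStrictTotalOrder; ⊎-<-wellFounded)
open import Data.Sum.Relation.Binary.Pointwise using (Pointwise-≡⇒≡; ≡⇒Pointwise-≡)
open import Function.Bundles using (Func; _↔_; _↣_)
open import Function.Base using (_∘_; id)
open import Induction.WellFounded using (WellFounded)
open import Level using (Level; Lift; _⊔_; 0ℓ) renaming (suc to lsuc)
open import Relation.Binary.Bundles using (Setoid)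
open import Relation.Binary.Core using (Rel)
open import Relation.Binary.Definitions using (Trichotomous; tri<; tri≈; tri>)
open import Relation.Binary.PropositionalEquality using (_≡_; refl; setoid; isEquivalence)
open import Relation.Binary.Structures using (IsStrictTotalOrder)
open import Relation.Nullary using (¬_; does)
open import Relation.Unary using (Pred; Irrelevant; _⊆_; _≐_)
open import Relation.Unary.Properties using (≐-refl; ≐-sym; ≐-trans)

------------------------------------------------------------------------
-- Ordinals, presented as well-ordered sets.  The carrier stands for the
-- set of predecessors, so "ξ < τ" is rendered as ξ : ∣ τ ∣.

record Ordinal (ℓ : Level) : Set (lsuc ℓ) where
  field
    ∣_∣                : Set ℓ
    _<_                : Rel ∣_∣ ℓ
    isStrictTotalOrder : IsStrictTotalOrder _≡_ _<_
    wellFounded        : WellFounded _<_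

open Ordinal public using (∣_∣)

finiteOrdinal : ℕ → Ordinal 0ℓ
finiteOrdinal n = record
  { ∣_∣                = Fin n
  ; _<_                = Fin._<_
  ; isStrictTotalOrder = Fin-<-isStrictTotalOrder
  ; wellFounded        = Fin-<-wellFounded
  }

infixl 6 _⊕_

_⊕_ : ∀ {a b} → Ordinal a → Ordinal b → Ordinal (a ⊔ b)
α ⊕ β = record
  { ∣_∣                = ∣ α ∣ ⊎ ∣ β ∣
  ; _<_                = A._<_ ⊎-< B._<_
  ; isStrictTotalOrder = record
    { isStrictPartialOrder = record
      { isEquivalence = isEquivalence
      ; irrefl        = S.irrefl ∘ ≡⇒Pointwise-≡
      ; trans         = S.trans
      ; <-resp-≈      = (λ { refl → id }) , (λ { refl → id })
      }
    ; compare = compare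
    }
  ; wellFounded = ⊎-<-wellFounded A.wellFounded B.wellFounded
  }
  where
  module A = Ordinal α
  module B = Ordinal β
  module S = IsStrictTotalOrder
    (⊎-<-isStrictTotalOrder A.isStrictTotalOrder B.isStrictTotalOrder)

  compare : Trichotomous _≡_ (A._<_ ⊎-< B._<_)
  compare x y with S.compare x y
  ... | tri< p ¬q ¬r = tri< p (¬q ∘ ≡⇒Pointwise-≡) ¬r
  ... | tri≈ ¬p q ¬r = tri≈ ¬p (Pointwise-≡⇒≡ q) ¬r
  ... | tri> ¬p ¬q r = tri> ¬p (¬q ∘ ≡⇒Pointwise-≡) r

------------------------------------------------------------------------
-- Cardinals.  A cardinal is represented by any set of that cardinality:
-- equality of cardinals is _↔_, and every notion below is invariant
-- under _↔_ (assuming function extensionality, in the case of _^ᶜ_).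

Cardinal : ∀ ℓ → Set (lsuc ℓ)
Cardinal ℓ = Set ℓ

finite : ∀ {ℓ} → ℕ → Cardinal ℓ
finite {ℓ} n = Lift ℓ (Fin n)

infixl 6 _+ᶜ_
infixr 8 _^ᶜ_
infix  4 _≤ᶜ_ _<ᶜ_

_+ᶜ_ : ∀ {ℓ} → Cardinal ℓ → Cardinal ℓ → Cardinal ℓ
κ +ᶜ μ = κ ⊎ μ

_^ᶜ_ : ∀ {ℓ} → Cardinal ℓ → Cardinal ℓ → Cardinal ℓ
μ ^ᶜ κ = κ → μ

_≤ᶜ_ : ∀ {ℓ} → Cardinal ℓ → Cardinal ℓ → Set ℓ
κ ≤ᶜ μ = κ ↣ μ

_<ᶜ_ : ∀ {ℓ} → Cardinal ℓ → Cardinal ℓ → Set ℓ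
κ <ᶜ μ = κ ≤ᶜ μ × ¬ (μ ≤ᶜ κ)

------------------------------------------------------------------------
-- Subsets.  Membership is required to be proof-irrelevant so that the
-- type of elements counts each member exactly once.

record Subset {ℓ} (A : Set ℓ) : Set (lsuc ℓ) where
  field
    Member     : Pred A ℓ
    irrelevant : Irrelevant Member

open Subset public using (Member)

HasCardinality : ∀ {ℓ} {A : Set ℓ} → Subset A → Cardinal ℓ → Set ℓ
HasCardinality X μ = ∃ (Member X) ↔ μ

-- The r-element subsets of A, identified when they have the same members.

_choose_ : ∀ {ℓ} → Set ℓ → ℕ → Setoid (lsuc ℓ) ℓ
A choose r = record
  { Carrier       = Σ[ T ∈ Subset A ] HasCardinality T (finite r)
  ; _≈_           = λ S T → Member (proj₁ S) ≐ Member (proj₁ T)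
  ; isEquivalence = record { refl = ≐-refl ; sym = ≐-sym ; trans = ≐-trans }
  }

------------------------------------------------------------------------
-- Partition relations

Colouring : ∀ {a c} → Set a → ℕ → Set c → Set (lsuc a ⊔ c)
Colouring A r C = Func (A choose r) (setoid C)

Monochromatic : ∀ {a c} {A : Set a} {r} {C : Set c} →
                Colouring A r C → C → Subset A → Set (lsuc a ⊔ c)
Monochromatic {A = A} {r} f ξ X =
  (T : Setoid.Carrier (A choose r)) → Member (proj₁ T) ⊆ Member X → Func.to f T ≡ ξ

-- κ ↛[ τ , Λ ]^ r  is  κ ↛ (Λ ξ)^r_{ξ<τ}.

infix 4 _↛[_,_]^_

_↛[_,_]^_ : ∀ {a c} → Cardinal a → (τ : Ordinal c) → (∣ τ ∣ → Cardinal a) → ℕ →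
            Set (lsuc a ⊔ c)
κ ↛[ τ , Λ ]^ r =
  Σ[ f ∈ Colouring κ r ∣ τ ∣ ]
    ¬ (∃[ ξ ] Σ[ X ∈ Subset κ ] (Monochromatic f ξ X × HasCardinality X (Λ ξ)))

------------------------------------------------------------------------
-- The number of additional colours; only the values at r ≥ 3 matter.

η : ℕ → ℕ
η r = if does (r ≟ 3) then 1
      else if does (2 ∣? r) then 2
      else 3

{-# OPTIONS --safe #-}
{-
Well-order κ, so that distinct x, y ∈ 2^κ have a first difference δ(x, y).  A finite subset of 2^κ
is then the set of leaves of a unique binary tree whose nodes carry the values of δ.  If the tree of
an (r + 1)-set T is a caterpillar (every node splits off a single leaf), then δ takes exactly r
values on T, and T gets the colour under f of this r-set.  Every other tree becomes, after removal
of the single leaves split off at its top, a tree whose root has at least two leaves on both sides.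
If an odd number of leaves was removed and the remaining tree has more than four leaves, T gets a
fixed colour of τ; otherwise T gets one of two extra colours, by the parity of the number of leaves
on the left of the original root.

A tree with at least five leaves that is not a caterpillar has two one-leaf deletions of which one
has an extra colour and the other does not have that same colour.  Hence no (r + 2)-set is
monochromatic in an extra colour, and all (r + 2)-subsets of a set X monochromatic in a colour of τ
are caterpillars; the latter means that δ never separates two points of X from two others.  From
this and one point of X to spare one finds as many values of δ as X has other points, such that any
r of them are the values of δ on an (r + 1)-subset of X.  They form a set monochromatic under f.

For r = 3 the only tree with four leaves that is not a caterpillar is the balanced one, so that only
one extra colour occurs; two extra colours suffice for all r > 3.
-}
module Submission where

open import Defs
open import Axiom.ExcludedMiddle using (ExcludedMiddle)
open import Axiom.Extensionality.Propositional using (Extensionality)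
open import Data.Bool.Base as Bool using (Bool; true; false; not; if_then_else_)
open import Data.Bool.Properties using (not-¬)
open import Data.Empty using (⊥; ⊥-elim)
open import Data.Fin.Base using (Fin; zero; suc)
open import Data.List.Base using (List; []; _∷_; _++_; length; lookup; map; tabulate)
open import Data.List.Membership.Propositional using (_∈_; _∉_)
open import Data.List.Membership.Propositional.Properties
  using (∈-++⁺ˡ; ∈-++⁺ʳ; ∈-++⁻; ∈-∃++; ∈-lookup; ∈-map⁺; ∈-map⁻; ∈-tabulate⁺; ∈-tabulate⁻)
open import Data.List.Membership.Propositional.Properties.WithK using (unique⇒irrelevant)
open import Data.List.Properties using (length-++; length-map; length-tabulate)
open import Data.List.Relation.Binary.Permutation.Propositional
  using (_↭_; prep; ↭-refl; ↭-sym; ↭-trans)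
open import Data.List.Relation.Binary.Permutation.Propositional.Properties
  using (++-comm; ++⁺ˡ; ++⁺ʳ; shift; ∈-resp-↭; ↭-length)
open import Data.List.Relation.Unary.All as All using ([]; _∷_)
open import Data.List.Relation.Unary.AllPairs using ([]; _∷_)
open import Data.List.Relation.Unary.Any using (here; there; index)
open import Data.List.Relation.Unary.Any.Properties using (lookup-index)
open import Data.List.Relation.Unary.Unique.Propositional using (Unique)
import Data.List.Relation.Unary.Unique.Propositional.Properties as Unique
open import Data.Nat.Base using (ℕ; zero; suc; _+_; _∸_; _≤_; _≡ᵇ_; z≤n; s≤s; s≤s⁻¹)
open import Data.Nat.Divisibility using (_∣?_)
open import Data.Nat.Properties
  using (_≟_; +-cancelʳ-≤; +-comm; +-mono-≤; +-monoʳ-≤; +-suc; <⇒≱; m∸n+n≡m; m≤m+n; m≤n+m;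
         m≤n⇒m≤1+n; n≤1+n; suc-injective; ≡ᵇ⇒≡; ≡⇒≡ᵇ; ≤-antisym; ≤-reflexive; ≤-trans; ≮⇒≥)
open import Data.Product.Base using (∃; ∃-syntax; Σ-syntax; _×_; _,_; proj₁; proj₂)
open import Data.Sum.Base using (_⊎_; inj₁; inj₂; [_,_]; map₂)
open import Data.Sum.Properties using (inj₁-injective; inj₂-injective)
open import Data.Unit.Base using (⊤)
open import Function.Bundles using (Func; Injection; Inverse; _↔_; mk↔ₛ′)
open import Level using (Lift; lift; lower)
open import Relation.Binary.Bundles using (Setoid)
open import Relation.Binary.Definitions using (Transitive; Trichotomous; tri<; tri≈; tri>)
open import Relation.Binary.PropositionalEquality
  using (_≡_; _≢_; cong; cong₂; refl; subst; sym; trans; ≢-sym)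
open import Relation.Nullary using (¬_; Dec; yes; no; contradiction; does)
open import Relation.Nullary.Decidable using (dec-false; dec-true; decidable-stable)

-- Zermelo's well-ordering theorem

record WellOrdering {ℓ} (K : Set ℓ) : Set (Level.suc ℓ) where
  field
    _<_     : K → K → Set ℓ
    <-trans : Transitive _<_
    compare : Trichotomous _≡_ _<_
    least   : (P : K → Set ℓ) → ∃ P → ∃[ m ] P m × (∀ y → y < m → ¬ P y)

module Zermelo (em : ∀ {a} → ExcludedMiddle a) (ext : ∀ {a b} → Extensionality a b)
               {ℓ} (K : Set ℓ) where

  ⌊_⌋ : ∀ {a} → Set a → Bool
  ⌊ P ⌋ = does (em {P = P})

  ⌊⌋-intro : ∀ {a} {P : Set a} → P → ⌊ P ⌋ ≡ true
  ⌊⌋-intro = dec-true em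

  ⌊⌋-elim : ∀ {a} {P : Set a} → ⌊ P ⌋ ≡ true → P
  ⌊⌋-elim {P = P} eq with em {P = P}
  ⌊⌋-elim eq | yes p = p

  private
    -- Boolean membership keeps subsets and families of subsets in `Set ℓ`, so that the union of any
    -- family is again a `Sub`.
    Sub : Set ℓ
    Sub = K → Bool

    _∋_ : Sub → K → Set
    S ∋ x = S x ≡ true

    _⊑_ : Sub → Sub → Set ℓ
    S ⊑ T = ∀ x → S ∋ x → T ∋ x

    ⊑-antisym : ∀ {S T} → S ⊑ T → T ⊑ S → S ≡ T
    ⊑-antisym S⊑T T⊑S = ext λ x → same _ _ (S⊑T x) (T⊑S x)
      where
      same : ∀ a b → (a ≡ true → b ≡ true) → (b ≡ true → a ≡ true) → a ≡ b
      same true  b     f g = sym (f refl)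
      same false true  f g = g refl
      same false false f g = refl

    -- Excluded middle for arbitrary types decides with a witness, so it also serves as a choice function.
    IsNext : ∀ S → Dec (∃[ m ] ¬ S ∋ m) → K → Set ℓ
    IsNext S (yes (m , _)) x = m ≡ x
    IsNext S (no _)        x = Lift ℓ ⊥

    next : Sub → Sub
    next S x = ⌊ S ∋ x ⊎ IsNext S em x ⌋

    ⊑-next : ∀ S → S ⊑ next S
    ⊑-next S x S∋x = ⌊⌋-intro (inj₁ S∋x)

    ⋃ : (Sub → Bool) → Sub
    ⋃ F x = ⌊ (∃[ S ] F S ≡ true × S ∋ x) ⌋

    data Tower : Sub → Set ℓ where
      step  : ∀ {S} → Tower S → Tower (next S)
      union : (F : Sub → Bool) → (∀ S → F S ≡ true → Tower S) → Tower (⋃ F)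

    ⋃-cases : ∀ F T → (∀ S → F S ≡ true → S ⊑ T ⊎ next T ⊑ S) → ⋃ F ⊑ T ⊎ next T ⊑ ⋃ F
    ⋃-cases F T split with em {P = ∃[ S ] F S ≡ true × next T ⊑ S}
    ... | yes (S , F∋S , T⊑S) = inj₂ λ x p → ⌊⌋-intro (S , F∋S , T⊑S x p)
    ... | no none = inj₁ λ x p → let (S , F∋S , S∋x) = ⌊⌋-elim p in
      [ (λ S⊑T → S⊑T x S∋x) , (λ T⊑S → contradiction (S , F∋S , T⊑S) none) ] (split S F∋S)

    -- Induction on both towers. In the step case the induction hypothesis may only give `S ⊑ T`;
    -- the inner induction `flip` then decides whether `T` equals `S` or already contains `next S`.
    linear : ∀ {S T} → Tower S → Tower T → S ⊑ T ⊎ next T ⊑ S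
    linear {T = T} (union F towers) t = ⋃-cases F T λ S F∋S → linear (towers S F∋S) t
    linear {T = T} (step {S} s) t with linear s t
    ... | inj₂ T⊑S = inj₂ λ x p → ⊑-next S x (T⊑S x p)
    ... | inj₁ S⊑T with flip t
      where
      flip : ∀ {T} → Tower T → T ⊑ S ⊎ next S ⊑ T
      flip (union G towers) = ⋃-cases G S λ T G∋T → flip (towers T G∋T)
      flip (step {T} t) with flip t
      ... | inj₂ S⊑T = inj₂ λ x p → ⊑-next T x (S⊑T x p)
      ... | inj₁ T⊑S with linear s t
      ...   | inj₂ T⊑S = inj₁ T⊑S
      ...   | inj₁ S⊑T = inj₂ (subst (λ U → next S ⊑ next U) (⊑-antisym S⊑T T⊑S) λ _ p → p)
    ...   | inj₂ S⊑T = inj₁ S⊑T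
    ...   | inj₁ T⊑S = inj₂ (subst (λ U → next T ⊑ next U) (⊑-antisym T⊑S S⊑T) λ _ p → p)

    comparable : ∀ {S T} → Tower S → Tower T → S ⊑ T ⊎ T ⊑ S
    comparable {T = T} s t = map₂ (λ T⊑S x p → T⊑S x (⊑-next T x p)) (linear s t)

    infix 4 _<_
    -- Towers are the initial segments of the order.
    _<_ : K → K → Set ℓ
    x < y = ∃[ S ] Tower S × S ∋ x × ¬ S ∋ y

    <-asym : ∀ {x y} → x < y → ¬ y < x
    <-asym {x} {y} (S , s , S∋x , S∌y) (T , t , T∋y , T∌x) with comparable s t
    ... | inj₁ S⊑T = T∌x (S⊑T x S∋x)
    ... | inj₂ T⊑S = S∌y (T⊑S y T∋y)

    <-trans : Transitive _<_
    <-trans {x} {y} {z} (S , s , S∋x , S∌y) (T , t , T∋y , T∌z) with comparable s t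
    ... | inj₁ S⊑T = T , t , S⊑T x S∋x , T∌z
    ... | inj₂ T⊑S = contradiction (T⊑S y T∋y) S∌y

    -- The witness is the element that next adds to the largest tower disjoint from P.
    minimum : ∀ {a} (P : K → Set a) → ∃ P → ∃[ m ] P m × (∀ y → P y → y ≢ m → m < y)
    -- The decision travels with its equation to `em`, so that `next J`, which is defined through
    -- `em`, can be matched with the branch taken.
    minimum P (p₀ , Pp₀) = pick em refl
      where
      Small : Sub → Set _
      Small S = Tower S × (∀ x → P x → ¬ S ∋ x)
      J : Sub
      J = ⋃ λ S → ⌊ Small S ⌋
      J-tower : Tower J
      J-tower = union _ λ S p → proj₁ (⌊⌋-elim p)
      J∌ : ∀ x → P x → ¬ J ∋ x
      J∌ x Px J∋x = let (S , small , S∋x) = ⌊⌋-elim J∋x in proj₂ (⌊⌋-elim small) x Px S∋x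
      pick : (d : Dec (∃[ m ] ¬ J ∋ m)) → d ≡ em → ∃[ m ] P m × (∀ y → P y → y ≢ m → m < y)
      pick (no all) _ = contradiction (p₀ , J∌ p₀ Pp₀) all
      pick (yes (m , J∌m)) eq = m , Pm , below
        where
        next∋m : next J ∋ m
        next∋m = ⌊⌋-intro (inj₂ (subst (λ d → IsNext J d m) eq refl))
        next-inv : ∀ x → next J ∋ x → J ∋ x ⊎ m ≡ x
        next-inv x p = map₂ (subst (λ d → IsNext J d x) (sym eq)) (⌊⌋-elim p)
        -- Otherwise `next J` would be a tower disjoint from `P`, hence part of `J`, and `m` would
        -- lie in `J`.
        Pm : P m
        Pm = decidable-stable em λ ¬Pm → J∌m (⌊⌋-intro
          (next J , ⌊⌋-intro (step J-tower , λ x Px q →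
            [ J∌ x Px , (λ { refl → ¬Pm Px }) ] (next-inv x q)) , next∋m))
        below : ∀ y → P y → y ≢ m → m < y
        below y Py y≢m = next J , step J-tower , next∋m , λ q →
          [ J∌ y Py , (λ m≡y → y≢m (sym m≡y)) ] (next-inv y q)

    compare : Trichotomous _≡_ _<_
    compare x y with em {P = x ≡ y}
    ... | yes refl = tri≈ (λ p → <-asym p p) refl (λ p → <-asym p p)
    ... | no x≢y with minimum (λ z → z ≡ x ⊎ z ≡ y) (x , inj₁ refl)
    ...   | _ , inj₁ refl , below = let x<y = below y (inj₂ refl) λ y≡x → x≢y (sym y≡x) in
                                    tri< x<y x≢y (<-asym x<y)
    ...   | _ , inj₂ refl , below = let y<x = below x (inj₁ refl) x≢y in
                                    tri> (<-asym y<x) x≢y y<x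

  wellOrdering : WellOrdering K
  wellOrdering = record
    { _<_     = _<_
    ; <-trans = <-trans
    ; compare = compare
    ; least   = λ P e → let (m , Pm , below) = minimum P e in
                        m , Pm , λ y y<m Py → <-asym y<m (below y Py λ { refl → <-asym y<m y<m })
    }

-- One-leaf deletions of binary trees

data Tree {a b} (K : Set a) (A : Set b) : Set (a Level.⊔ b) where
  leaf : A → Tree K A
  node : K → Tree K A → Tree K A → Tree K A

odd? : ℕ → Bool
odd? zero    = false
odd? (suc n) = not (odd? n)

-- core₄, even and odd describe a tree by what is left when the single leaves at its top are stripped
-- off: four leaves, or else the parity of the number of stripped leaves.
data Kind : Set where
  caterpillar core₄ even odd : Kind

strip : Kind → Kind
strip caterpillar = caterpillar
strip core₄       = core₄
strip even        = odd
strip odd         = even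

-- What the colouring sees of a tree: `chain` defers to `f`, `spare` gets the fixed colour of τ,
-- `extra` one of the additional colours.
data Class : Set where
  chain spare : Class
  extra       : Bool → Class

classOf : Kind → ℕ → Class
classOf caterpillar _ = chain
classOf odd         _ = spare
classOf core₄       n = extra (odd? n)
classOf even        n = extra (odd? n)

module _ {a b} {K : Set a} {A : Set b} where

  private
    variable
      t t′ p p′ q q′ : Tree K A
      x y : A
      α : K

  size : Tree K A → ℕ
  size (leaf _)     = 1
  size (node _ p q) = size p + size q

  kind : Tree K A → Kind
  kind (leaf _)                            = caterpillar
  kind (node _ (leaf _) q)                 = strip (kind q)
  kind (node _ p@(node _ _ _) (leaf _))    = strip (kind p)
  kind (node _ p@(node _ _ _) q@(node _ _ _)) = if size p + size q ≡ᵇ 4 then core₄ else even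

  leaves : Tree K A → List A
  leaves (leaf x)     = x ∷ []
  leaves (node _ p q) = leaves p ++ leaves q

  labels : Tree K A → List K
  labels (leaf _)     = []
  labels (node α p q) = α ∷ labels p ++ labels q

  length-leaves : ∀ t → length (leaves t) ≡ size t
  length-leaves (leaf _)     = refl
  length-leaves (node _ p q) =
    trans (length-++ (leaves p)) (cong₂ _+_ (length-leaves p) (length-leaves q))

  length-labels : ∀ t → suc (length (labels t)) ≡ size t
  length-labels (leaf _)     = refl
  length-labels (node _ p q) = trans (cong (λ n → suc (suc n)) (length-++ (labels p)))
    (trans (cong suc (sym (+-suc (length (labels p)) _)))
      (cong₂ _+_ (length-labels p) (length-labels q)))

  leftSize : Tree K A → ℕ
  leftSize (leaf _)     = 0
  leftSize (node _ p _) = size p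

  class : Tree K A → Class
  class t = classOf (kind t) (leftSize t)

  infix 4 _⊏_
  -- Deleting a leaf contracts its parent, so that every node of the result still has two subtrees.
  data _⊏_ : Tree K A → Tree K A → Set (a Level.⊔ b) where
    dropˡ : q ⊏ node α (leaf x) q
    dropʳ : p ⊏ node α p (leaf x)
    inˡ   : p′ ⊏ p → node α p′ q ⊏ node α p q
    inʳ   : q′ ⊏ q → node α p q′ ⊏ node α p q

  size-⊏ : t′ ⊏ t → size t ≡ suc (size t′)
  size-⊏ dropˡ = refl
  size-⊏ {t′ = p} dropʳ = +-comm (size p) 1
  size-⊏ {t = node _ _ q} (inˡ d) = cong (_+ size q) (size-⊏ d)
  size-⊏ {t = node _ p _} (inʳ d) = trans (cong (size p +_) (size-⊏ d)) (+-suc (size p) _)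

  deletion : ∀ α p q → ∃[ t ] t ⊏ node {A = A} α p q
  deletion α (leaf x)       q = q , dropˡ
  deletion α (node β p₁ p₂) q = let (_ , d) = deletion β p₁ p₂ in _ , inˡ d

  1≤size : ∀ t → 1 ≤ size t
  1≤size (leaf _)     = s≤s z≤n
  1≤size (node _ p q) = ≤-trans (1≤size p) (m≤m+n (size p) (size q))

  2≤size : ∀ α p q → 2 ≤ size (node α p q)
  2≤size _ p q = +-mono-≤ (1≤size p) (1≤size q)

  -- Caterpillars, and the kinds of trees after a deletion

  data Caterpillar : Tree K A → Set (a Level.⊔ b) where
    leaf  : Caterpillar (leaf x)
    nodeˡ : Caterpillar q → Caterpillar (node α (leaf x) q)
    nodeʳ : Caterpillar p → Caterpillar (node α p (leaf x))

  strip-caterpillar : ∀ k → strip k ≡ caterpillar → k ≡ caterpillar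
  strip-caterpillar caterpillar _ = refl

  kind⇒caterpillar : ∀ t → kind t ≡ caterpillar → Caterpillar t
  kind⇒caterpillar (leaf _) _ = leaf
  kind⇒caterpillar (node _ (leaf _) q) eq =
    nodeˡ (kind⇒caterpillar q (strip-caterpillar _ eq))
  kind⇒caterpillar (node _ p@(node _ _ _) (leaf _)) eq =
    nodeʳ (kind⇒caterpillar p (strip-caterpillar _ eq))
  kind⇒caterpillar (node _ p@(node _ _ _) q@(node _ _ _)) eq with size p + size q ≡ᵇ 4
  kind⇒caterpillar (node _ (node _ _ _) (node _ _ _)) () | true
  kind⇒caterpillar (node _ (node _ _ _) (node _ _ _)) () | false

  caterpillar⇒kind : Caterpillar t → kind t ≡ caterpillar
  caterpillar⇒kind leaf                                = refl
  caterpillar⇒kind (nodeˡ c)                           = cong strip (caterpillar⇒kind c)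
  caterpillar⇒kind (nodeʳ {p = leaf _} c)              = refl
  caterpillar⇒kind (nodeʳ {p = node _ _ _} c)          = cong strip (caterpillar⇒kind c)

  class-kind : ∀ t {k} → kind t ≡ k → class t ≡ classOf k (leftSize t)
  class-kind t = cong (λ k → classOf k (leftSize t))

  caterpillar⇒class : Caterpillar t → class t ≡ chain
  caterpillar⇒class {t} c = class-kind t (caterpillar⇒kind c)

  caterpillar-⊏ : ∀ α p q → Caterpillar (node {A = A} α p q) →
                  ∃[ t ] t ⊏ node α p q × Caterpillar t
  caterpillar-⊏ _ _ _ (nodeˡ c) = _ , dropˡ , c
  caterpillar-⊏ _ _ _ (nodeʳ c) = _ , dropʳ , c

  -- A root with nodes on both sides has at least four leaves below it.
  size≤3⇒caterpillar : ∀ t → size t ≤ 3 → Caterpillar t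
  size≤3⇒caterpillar (leaf _) _ = leaf
  size≤3⇒caterpillar (node _ (leaf _) q) (s≤s le) =
    nodeˡ (size≤3⇒caterpillar q (m≤n⇒m≤1+n le))
  size≤3⇒caterpillar (node _ p@(node _ _ _) (leaf _)) le =
    nodeʳ (size≤3⇒caterpillar p (≤-trans (m≤m+n (size p) 1) le))
  size≤3⇒caterpillar (node _ (node α p₁ p₂) (node β q₁ q₂)) le =
    contradiction (+-mono-≤ (2≤size α p₁ p₂) (2≤size β q₁ q₂)) (<⇒≱ (s≤s le))

  strip-core₄ : ∀ k → strip k ≡ core₄ → k ≡ core₄
  strip-core₄ core₄ _ = refl

  -- Tells a tree of two leaves (`inj₁`) from a larger one, which keeps at least two leaves after a
  -- deletion (`inj₂`).
  shrink : ∀ α p q → (∃[ x ] leaf x ⊏ node {A = A} α p q) ⊎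
                     (∃[ β ] ∃[ p′ ] ∃[ q′ ] node β p′ q′ ⊏ node α p q)
  shrink α (leaf _)       (leaf x)       = inj₁ (x , dropˡ)
  shrink α (leaf _)       (node _ _ _)   = inj₂ (_ , _ , _ , dropˡ)
  shrink α (node β p₁ p₂) q              =
    inj₂ (_ , _ , _ , inˡ (proj₂ (deletion β p₁ p₂)))

  kind-split : ∀ α β p₁ p₂ γ q₁ q₂ → let t = node {A = A} α (node β p₁ p₂) (node γ q₁ q₂) in
               (size t ≡ 4 × kind t ≡ core₄) ⊎ (size t ≢ 4 × kind t ≡ even)
  kind-split α β p₁ p₂ γ q₁ q₂
    with size p₁ + size p₂ + (size q₁ + size q₂) ≡ᵇ 4 in eq
  ... | true  = inj₁ (≡ᵇ⇒≡ _ 4 (subst Bool.T (sym eq) _) , refl)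
  ... | false = inj₂ ((λ eq4 → subst Bool.T eq (≡⇒≡ᵇ _ 4 eq4)) , refl)

  -- Deleting a leaf of the core leaves three leaves there, hence a caterpillar, and it remains one
  -- under the single leaves above it.
  core₄-⊏ : ∀ t → kind t ≡ core₄ → ∃[ t′ ] t′ ⊏ t × Caterpillar t′
  core₄-⊏ (node _ (leaf _) q) eq =
    let (_ , d , c) = core₄-⊏ q (strip-core₄ _ eq) in _ , inʳ d , nodeˡ c
  core₄-⊏ (node _ p@(node _ _ _) (leaf _)) eq =
    let (_ , d , c) = core₄-⊏ p (strip-core₄ _ eq) in _ , inˡ d , nodeʳ c
  core₄-⊏ (node α (node β p₁ p₂) (node γ q₁ q₂)) eq with kind-split α β p₁ p₂ γ q₁ q₂
  ... | inj₂ (_ , eq′) = contradiction (trans (sym eq) eq′) λ ()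
  ... | inj₁ (eq4 , _) =
    let (p , d) = deletion β p₁ p₂
        d′ : node α p (node γ q₁ q₂) ⊏ node α (node β p₁ p₂) (node γ q₁ q₂)
        d′ = inˡ d
    in _ , d′ , size≤3⇒caterpillar _ (≤-reflexive (suc-injective (trans (sym (size-⊏ d′)) eq4)))

  -- The second alternative is for a core of five leaves, split as two and three: a deletion on the
  -- side of two gives a caterpillar, one on the side of three a core of four.
  Stable : Tree K A → Set _
  Stable t = (∃[ t′ ] t′ ⊏ t × kind t′ ≡ kind t) ⊎
             ((∃[ t′ ] t′ ⊏ t × Caterpillar t′) × (∃[ t′ ] t′ ⊏ t × kind t′ ≡ core₄))

  stable : ∀ t → kind t ≢ caterpillar → kind t ≢ core₄ → Stable t
  stable (leaf _) ≢cat _ = contradiction refl ≢cat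
  stable (node _ (leaf _) q) ≢cat ≢core
    with stable q (λ eq → ≢cat (cong strip eq)) (λ eq → ≢core (cong strip eq))
  ... | inj₁ (_ , d , eq) = inj₁ (_ , inʳ d , cong strip eq)
  ... | inj₂ ((_ , d , c) , (_ , e , eq)) = inj₂ ((_ , inʳ d , nodeˡ c) , (_ , inʳ e , cong strip eq))
  stable (node _ p@(node _ _ _) (leaf _)) ≢cat ≢core
    with stable p (λ eq → ≢cat (cong strip eq)) (λ eq → ≢core (cong strip eq))
  -- By `eq`, deleting down to a single leaf would make `p` a caterpillar.
  ... | inj₁ (leaf _ , d , eq) = contradiction (cong strip (sym eq)) ≢cat
  ... | inj₁ (node _ _ _ , d , eq) = inj₁ (_ , inˡ d , cong strip eq)
  ... | inj₂ ((_ , d , c) , (node _ _ _ , e , eq)) =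
    inj₂ ((_ , inˡ d , nodeʳ c) , (_ , inˡ e , cong strip eq))
  stable (node α p@(node β p₁ p₂) q@(node γ q₁ q₂)) _ ≢core with kind-split α β p₁ p₂ γ q₁ q₂
  ... | inj₁ (_ , eq) = contradiction eq ≢core
  ... | inj₂ (≢4 , t-even) = cases (shrink β p₁ p₂) (shrink γ q₁ q₂)
    where
    P : Tree K A
    P = node β p₁ p₂
    Q : Tree K A
    Q = node γ q₁ q₂

    too-big : ∀ {m n} → 2 ≤ m → 3 ≤ n → m + n ≢ 4
    too-big 2≤m 3≤n eq = <⇒≱ (+-mono-≤ 2≤m 3≤n) (≤-reflexive eq)

    ≤2 : ∀ {m n} → 2 ≤ m → m + n ≡ 4 → suc n ≤ 3
    ≤2 {m} {n} 2≤m eq = ≮⇒≥ λ 3<1+n → too-big 2≤m (s≤s⁻¹ 3<1+n) eq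

    3≤ : ∀ α p q {t} → node α p q ⊏ t → 3 ≤ size t
    3≤ α p q d = subst (3 ≤_) (sym (size-⊏ d)) (s≤s (2≤size α p q))

    small : ∀ {p t n} → 2 ≤ n → p ⊏ t → n + size p ≡ 4 → Caterpillar t
    small 2≤n d eq = size≤3⇒caterpillar _ (≤-trans (≤-reflexive (size-⊏ d)) (≤2 2≤n eq))

    cases : _ → _ → Stable (node α P Q)
    cases (inj₁ (_ , d)) (inj₁ (_ , e)) =
      contradiction (cong₂ _+_ (size-⊏ d) (size-⊏ e)) ≢4
    cases (inj₂ (β′ , p₁′ , p₂′ , d)) s with kind-split α β′ p₁′ p₂′ γ q₁ q₂ | s
    ... | inj₂ (_ , eq) | _ = inj₁ (_ , inˡ d , trans eq (sym t-even))
    ... | inj₁ (eq4 , eq) | inj₁ (_ , e) =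
      inj₂ ((_ , inʳ e , nodeʳ (small (2≤size γ q₁ q₂) d (trans (+-comm (size Q) _) eq4)))
           , _ , inˡ d , eq)
    ... | inj₁ (eq4 , _) | inj₂ (γ′ , q₁′ , q₂′ , e) =
      contradiction eq4 (too-big (2≤size β′ p₁′ p₂′) (3≤ γ′ q₁′ q₂′ e))
    cases (inj₁ (_ , d)) (inj₂ (γ′ , q₁′ , q₂′ , e)) with kind-split α β p₁ p₂ γ′ q₁′ q₂′
    ... | inj₂ (_ , eq) = inj₁ (_ , inʳ e , trans eq (sym t-even))
    ... | inj₁ (eq4 , eq) =
      inj₂ ((_ , inˡ d , nodeˡ (small (2≤size β p₁ p₂) e eq4)) , _ , inʳ e , eq)

  class-extra : ∀ t {b} → class t ≡ extra b → b ≡ odd? (leftSize t)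
  class-extra t eq with kind t
  class-extra t refl | core₄ = refl
  class-extra t refl | even  = refl

  class-split : ∀ α β p₁ p₂ γ q₁ q₂ →
                class (node α (node β p₁ p₂) (node γ q₁ q₂)) ≡ extra (odd? (size p₁ + size p₂))
  class-split α β p₁ p₂ γ q₁ q₂ with kind-split α β p₁ p₂ γ q₁ q₂
  ... | inj₁ (_ , eq) = class-kind (node α (node β p₁ p₂) (node γ q₁ q₂)) eq
  ... | inj₂ (_ , eq) = class-kind (node α (node β p₁ p₂) (node γ q₁ q₂)) eq

  Separated : Tree K A → Set _
  Separated t = ∃[ b ] (∃[ t′ ] t′ ⊏ t × class t′ ≡ extra b) × (∃[ t′ ] t′ ⊏ t × class t′ ≢ extra b)

  -- Here `t` is `q` with a single leaf on top. Removing that leaf gives `q`, while a deletion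
  -- inside `q` keeps it. If the latter preserves the kind `even` or `odd` of `q`, the numbers of
  -- stripped leaves differ in parity, so that one result is `spare` and the other extra. Failing
  -- that, a deletion to a caterpillar or to a core of four leaves provides the contrast.
  separated-strip : ∀ t q → q ⊏ t → kind t ≡ strip (kind q) → kind q ≢ caterpillar →
                    (∀ q′ → q′ ⊏ q → ∃[ t′ ] t′ ⊏ t × kind t′ ≡ strip (kind q′)) → Separated t
  separated-strip t q q⊏t t-kind ≢cat embed = go (kind q) refl
    where
    spoil : ∀ {t k b} → kind t ≡ k → (∀ n → classOf k n ≢ extra b) → class t ≢ extra b
    spoil {t} eq ne eq′ = ne (leftSize t) (trans (sym (class-kind t eq)) eq′)

    embed′ : ∀ {q′ k} → q′ ⊏ q → kind q′ ≡ k → ∃[ t′ ] t′ ⊏ t × kind t′ ≡ strip k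
    embed′ d eq = let (t′ , d′ , eq′) = embed _ d in t′ , d′ , trans eq′ (cong strip eq)

    go : ∀ k → kind q ≡ k → Separated t
    go caterpillar eq = contradiction eq ≢cat
    go core₄ eq =
      let (_ , d , c) = core₄-⊏ q eq
          (t′ , d′ , eq′) = embed′ d (caterpillar⇒kind c)
      in _ , (q , q⊏t , class-kind q eq) , t′ , d′ , spoil {t′} eq′ λ _ ()
    go even eq with stable q ≢cat (λ eq′ → contradiction (trans (sym eq) eq′) λ ())
    ... | inj₁ (_ , d , same) = let (t′ , d′ , eq′) = embed′ d (trans same eq) in
      _ , (q , q⊏t , class-kind q eq) , t′ , d′ , spoil {t′} eq′ λ _ ()
    ... | inj₂ ((_ , d , c) , _) = let (t′ , d′ , eq′) = embed′ d (caterpillar⇒kind c) in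
      _ , (q , q⊏t , class-kind q eq) , t′ , d′ , spoil {t′} eq′ λ _ ()
    go odd eq with stable q ≢cat (λ eq′ → contradiction (trans (sym eq) eq′) λ ())
    ... | inj₁ (_ , d , same) = let (t′ , d′ , eq′) = embed′ d (trans same eq) in
      _ , (t′ , d′ , class-kind t′ eq′) , q , q⊏t , spoil {q} eq λ _ ()
    ... | inj₂ (_ , _ , d , core) = let (t′ , d′ , eq′) = embed′ d core in
      _ , (t′ , d′ , class-kind t′ eq′) , q , q⊏t , spoil {q} eq λ _ ()

  separated : ∀ t → 5 ≤ size t → kind t ≢ caterpillar → Separated t
  separated (leaf _) (s≤s ()) _
  separated t@(node _ (leaf _) q) _ ≢cat =
    separated-strip t q dropˡ refl (λ eq → ≢cat (cong strip eq)) λ _ d → _ , inʳ d , refl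
  separated t@(node α p@(node β p₁ p₂) (leaf x)) _ ≢cat =
    separated-strip t p dropʳ refl (λ eq → ≢cat (cong strip eq)) λ p′ d → _ , inˡ d , strip-leaf p′
    where
    strip-leaf : ∀ p → kind (node α p (leaf x)) ≡ strip (kind p)
    strip-leaf (leaf _)     = refl
    strip-leaf (node _ _ _) = refl
  separated (node α P@(node β p₁ p₂) Q@(node γ q₁ q₂)) 5≤ _ = cases (shrink β p₁ p₂) (shrink γ q₁ q₂)
    where
    flips : ∀ {p} → p ⊏ P → odd? (size p) ≢ odd? (size P)
    flips {p} d eq = not-¬ (sym eq) (cong odd? (size-⊏ d))

    cases : _ → _ → Separated (node α P Q)
    -- A deletion on the left changes the parity of the left size, one on the right keeps it. The
    -- first tree named must keep two leaves on both sides, so that its class is certainly extra.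
    cases (inj₂ (β′ , p₁′ , p₂′ , d)) _ = let (q , e) = deletion γ q₁ q₂ in
      _ , (_ , inˡ d , class-split α β′ p₁′ p₂′ γ q₁ q₂) ,
      (_ , inʳ e , λ eq → flips d (class-extra (node α P q) eq))
    cases (inj₁ (x , d)) (inj₂ (γ′ , q₁′ , q₂′ , e)) =
      _ , (_ , inʳ e , class-split α β p₁ p₂ γ′ q₁′ q₂′) ,
      (_ , inˡ d , λ eq → flips d (sym (class-extra (node α (leaf x) Q) eq)))
    cases (inj₁ (_ , d)) (inj₁ (_ , e)) =
      contradiction (subst (5 ≤_) (cong₂ _+_ (size-⊏ d) (size-⊏ e)) 5≤) λ { (s≤s (s≤s (s≤s (s≤s ())))) }

  -- With four leaves, only the split into two and two is not a caterpillar. This is why one extra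
  -- colour is enough for r = 3.
  extra-4 : ∀ t {b} → size t ≡ 4 → class t ≡ extra b → b ≡ false
  extra-4 (node α (leaf x) q) eq4 eq = contradiction
    (trans (sym eq) (caterpillar⇒class (nodeˡ {α = α} {x = x}
      (size≤3⇒caterpillar q (≤-reflexive (suc-injective eq4))))))
    λ ()
  extra-4 (node α p@(node _ _ _) (leaf x)) eq4 eq = contradiction
    (trans (sym eq) (caterpillar⇒class (nodeʳ {α = α} {x = x}
      (size≤3⇒caterpillar p (≤-reflexive (suc-injective (trans (+-comm 1 (size p)) eq4)))))))
    λ ()
  extra-4 t@(node _ p@(node β p₁ p₂) q@(node γ q₁ q₂)) eq4 eq =
    trans (class-extra t eq) (cong odd? (≤-antisym
      (+-cancelʳ-≤ 2 (size p) 2 (≤-trans (+-monoʳ-≤ (size p) (2≤size γ q₁ q₂)) (≤-reflexive eq4)))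
      (2≤size β p₁ p₂)))

-- First differences and the trees of finite sets

pattern 0₂ = lift zero
pattern 1₂ = lift (suc zero)

≢-≢⇒≡ : ∀ {ℓ} {a b c : Lift ℓ (Fin 2)} → a ≢ b → b ≢ c → a ≡ c
≢-≢⇒≡ {a = 0₂} {_}  {0₂} _ _ = refl
≢-≢⇒≡ {a = 1₂} {_}  {1₂} _ _ = refl
≢-≢⇒≡ {a = 0₂} {0₂} {1₂} a≢b _ = contradiction refl a≢b
≢-≢⇒≡ {a = 0₂} {1₂} {1₂} _ b≢c = contradiction refl b≢c
≢-≢⇒≡ {a = 1₂} {0₂} {0₂} _ b≢c = contradiction refl b≢c
≢-≢⇒≡ {a = 1₂} {1₂} {0₂} a≢b _ = contradiction refl a≢b

module Levels (em : ∀ {a} → ExcludedMiddle a) (ext : ∀ {a b} → Extensionality a b)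
              {ℓ} {K : Set ℓ} (wo : WellOrdering K) where

  open WellOrdering wo

  A : Set ℓ
  A = K → Lift ℓ (Fin 2)

  private
    variable
      α β γ : K
      u v w x y z : A
      t t′ p q : Tree K A

  Agree : K → A → A → Set ℓ
  Agree α x y = ∀ β → β < α → x β ≡ y β

  Agree-sym : Agree α x y → Agree α y x
  Agree-sym xy β β<α = sym (xy β β<α)

  Agree-trans : Agree α x y → Agree α y z → Agree α x z
  Agree-trans xy yz β β<α = trans (xy β β<α) (yz β β<α)

  -- D α x y says that δ(x , y) = α.
  D : K → A → A → Set ℓ
  D α x y = Agree α x y × x α ≢ y α

  D-sym : D α x y → D α y x
  D-sym (xy , x≢y) = Agree-sym xy , ≢-sym x≢y

  D-irrefl : ¬ D α x x
  D-irrefl (_ , x≢x) = x≢x refl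

  D⇒≢ : D α x y → x ≢ y
  D⇒≢ d refl = D-irrefl d

  D-unique : D α x y → D β x y → α ≡ β
  D-unique {α} {β = β} (xyα , ≢α) (xyβ , ≢β) with compare α β
  ... | tri< α<β _ _ = contradiction (xyβ α α<β) ≢α
  ... | tri≈ _ α≡β _ = α≡β
  ... | tri> _ _ β<α = contradiction (xyα β β<α) ≢β

  -- Only two values are available at α.
  D-triangle : D α x y → D α y z → ¬ D α x z
  D-triangle (_ , x≢y) (_ , y≢z) (_ , x≢z) = x≢z (≢-≢⇒≡ x≢y y≢z)

  -- The values at α alternate along `u`, `x`, `y`, `z`.
  D-path : D α u x → D α x y → D α y z → D α u z
  D-path (ux , u≢x) (xy , x≢y) (yz , y≢z) =
    Agree-trans ux (Agree-trans xy yz) , λ u≡z → u≢x (trans u≡z (sym (≢-≢⇒≡ x≢y y≢z)))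

  -- The ultrametric law for δ: a point that leaves `y` before level α leaves `z` at the same place.
  D-step : D β x y → β < α → Agree α y z → D β x z
  D-step (xy , x≢y) β<α yz =
    (λ γ γ<β → trans (xy γ γ<β) (yz γ (<-trans γ<β β<α))) , λ x≡z → x≢y (trans x≡z (sym (yz _ β<α)))

  differ : x ≢ y → ∃[ α ] D α x y
  differ {x} {y} x≢y =
    let (α , x≢yα , below) = least (λ α → x α ≢ y α) some
    in α , (λ β β<α → decidable-stable em (below β β<α)) , x≢yα
    where
    some : ∃[ α ] x α ≢ y α
    some = decidable-stable em λ none → x≢y (ext λ α → decidable-stable em λ ne → none (α , ne))

  -- A fork is a level at which two points are separated from two others, that is, a branching with
  -- at least two points on both sides.
  ForkFree : (A → Set ℓ) → Set ℓ
  ForkFree X = ∀ {α x u z v} → X x → X u → X z → X v → x ≢ u → z ≢ v →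
               D α x z → D α x v → D α u z → D α u v → ⊥

  -- The orientation, value 0 on the left, makes the tree of a set unique and its left size
  -- meaningful.
  Split : K → A → A → Set ℓ
  Split α x y = Agree α x y × x α ≡ 0₂ × y α ≡ 1₂

  split⇒D : Split α x y → D α x y
  split⇒D (xy , x0 , y1) = xy , λ x≡y → contradiction (trans (sym x0) (trans x≡y y1)) λ ()

  -- Existence of the tree of a finite set

  Valid : Tree K A → Set ℓ
  Valid (leaf _)     = Lift ℓ ⊤
  Valid (node α p q) = Valid p × Valid q × (∀ {y z} → y ∈ leaves p → z ∈ leaves q → Split α y z)

  some-leaf : ∀ (t : Tree K A) → ∃[ x ] x ∈ leaves t
  some-leaf (leaf x)     = x , here refl
  some-leaf (node _ p _) = let (x , x∈p) = some-leaf p in x , ∈-++⁺ˡ x∈p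

  -- Leaves on different sides agree below α by validity, and leaves on the same side through a leaf
  -- of the other.
  agree : Valid (node α p q) → x ∈ leaves (node α p q) → y ∈ leaves (node α p q) → Agree α x y
  agree {α} {p} {q} (_ , _ , pq) x∈t y∈t = Agree-trans (to-p x∈t) (Agree-sym (to-p y∈t))
    where
    y₀ : A
    y₀ = proj₁ (some-leaf p)
    to-p : x ∈ leaves (node α p q) → Agree α x y₀
    to-p x∈t with ∈-++⁻ (leaves p) x∈t
    ... | inj₁ x∈p = Agree-trans (proj₁ (pq x∈p (proj₂ (some-leaf q))))
                       (Agree-sym (proj₁ (pq (proj₂ (some-leaf p)) (proj₂ (some-leaf q)))))
    ... | inj₂ x∈q = Agree-sym (proj₁ (pq (proj₂ (some-leaf p)) x∈q))

  leaves-unique : ∀ t → Valid t → Unique (leaves t)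
  leaves-unique (leaf _)     _ = [] ∷ []
  leaves-unique (node _ p q) (vp , vq , pq) =
    Unique.++⁺ (leaves-unique p vp) (leaves-unique q vq)
      λ (x∈p , x∈q) → D-irrefl (split⇒D (pq x∈p x∈q))

  -- One value 0 on the side of `p` forces 1 on all of `q`, and this in turn 0 on all of `p`.
  split-all : ∀ (p q : Tree K A) → (∀ {y z} → y ∈ leaves p → z ∈ leaves q → D α y z) →
              x ∈ leaves p → x α ≡ 0₂ → y ∈ leaves p → z ∈ leaves q → Split α y z
  split-all {α} {x = x} p q pq x∈p x0 y∈p z∈q =
    proj₁ (pq y∈p z∈q) , decide (λ y1 → proj₂ (pq y∈p z∈q) (trans y1 (sym (z1 z∈q)))) , z1 z∈q
    where
    decide : ∀ {b : Lift ℓ (Fin 2)} → b ≢ 1₂ → b ≡ 0₂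
    decide {0₂} _ = refl
    decide {1₂} ne = contradiction refl ne
    z1 : z ∈ leaves q → z α ≡ 1₂
    z1 z∈q = ≢-≢⇒≡ {b = 0₂} (λ z0 → proj₂ (pq x∈p z∈q) (trans x0 (sym z0))) λ ()

  TreeOn : List A → Set ℓ
  TreeOn l = ∃[ t ] Valid t × leaves t ↭ l

  -- Which tree goes to the left is read off from the values at α of one leaf of each.
  join : ∀ α p q → Valid p → Valid q → (∀ {y z} → y ∈ leaves p → z ∈ leaves q → D α y z) →
         TreeOn (leaves p ++ leaves q)
  join α p q vp vq pq = let (x , x∈p) = some-leaf p; (z , z∈q) = some-leaf q in
    orient x∈p z∈q (x α) (z α) refl refl
    where
    orient : x ∈ leaves p → z ∈ leaves q → ∀ a b → x α ≡ a → z α ≡ b → TreeOn (leaves p ++ leaves q)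
    orient x∈p z∈q 0₂ _ x0 _ = node α p q , (vp , vq , split-all p q pq x∈p x0) , ↭-refl
    orient x∈p z∈q 1₂ 0₂ _ z0 =
      node α q p , (vq , vp , split-all q p (λ y∈q w∈p → D-sym (pq w∈p y∈q)) z∈q z0) ,
      ++-comm (leaves q) (leaves p)
    orient x∈p z∈q 1₂ 1₂ x1 z1 = contradiction (trans x1 (sym z1)) (proj₂ (pq x∈p z∈q))

  -- If `x` departs from the other leaves before the root label, it is attached at a new root;
  -- otherwise its value at the root label tells the subtree into which it goes.
  insert : ∀ x t → Valid t → x ∉ leaves t → TreeOn (x ∷ leaves t)
  insert x (leaf y) _ x∉ =
    let (α , d) = differ λ x≡y → x∉ (here x≡y)
    in join α (leaf x) (leaf y) _ _ λ { (here refl) (here refl) → d }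
  insert x t@(node α p q) v@(vp , vq , pq) x∉ = go em
    where
    y₀ : A
    y₀ = proj₁ (some-leaf t)
    y₀∈ : y₀ ∈ leaves t
    y₀∈ = proj₂ (some-leaf t)
    low : ¬ Agree α x y₀ → ∃[ β ] β < α × D β x y₀
    low ¬agree with differ {x = x} {y = y₀} (λ x≡y₀ → x∉ (subst (_∈ leaves t) (sym x≡y₀) y₀∈))
    ... | β , d with compare β α
    ...   | tri< β<α _ _ = β , β<α , d
    ...   | tri≈ _ refl _ = contradiction (proj₁ d) ¬agree
    ...   | tri> _ _ α<β = contradiction (λ γ γ<α → proj₁ d γ (<-trans γ<α α<β)) ¬agree
    go : Dec (Agree α x y₀) → TreeOn (x ∷ leaves t)
    go (no ¬agree) = let (β , β<α , d) = low ¬agree in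
      join β (leaf x) t _ v λ { (here refl) z∈t → D-step d β<α (agree {p = p} {q = q} v y₀∈ z∈t) }
    go (yes xy₀) with x α in eq
    ... | 0₂ = let (p′ , vp′ , p↭) = insert x p vp (λ x∈p → x∉ (∈-++⁺ˡ x∈p)) in
      node α p′ q , (vp′ , vq , λ {y} {z} y∈p′ z∈q → cross (∈-resp-↭ p↭ y∈p′) z∈q) , ++⁺ʳ (leaves q) p↭
      where
      cross : y ∈ x ∷ leaves p → z ∈ leaves q → Split α y z
      cross (there y∈p) z∈q = pq y∈p z∈q
      cross (here refl) z∈q =
        Agree-trans xy₀ (agree {p = p} {q = q} v y₀∈ (∈-++⁺ʳ (leaves p) z∈q)) , eq ,
        proj₂ (proj₂ (pq (proj₂ (some-leaf p)) z∈q))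
    ... | 1₂ = let (q′ , vq′ , q↭) = insert x q vq (λ x∈q → x∉ (∈-++⁺ʳ (leaves p) x∈q)) in
      node α p q′ , (vp , vq′ , λ {y} {z} y∈p z∈q′ → cross y∈p (∈-resp-↭ q↭ z∈q′)) ,
      ↭-trans (++⁺ˡ (leaves p) q↭) (shift x (leaves p) (leaves q))
      where
      cross : y ∈ leaves p → z ∈ x ∷ leaves q → Split α y z
      cross y∈p (there z∈q) = pq y∈p z∈q
      cross y∈p (here refl) =
        Agree-trans (agree {p = p} {q = q} v (∈-++⁺ˡ y∈p) y₀∈) (Agree-sym xy₀) ,
        proj₁ (proj₂ (pq y∈p (proj₂ (some-leaf q)))) , eq

  treeOf : ∀ l → Unique l → length l ≢ 0 → TreeOn l
  treeOf [] _ ne = contradiction refl ne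
  treeOf (x ∷ []) _ _ = leaf x , _ , ↭-refl
  treeOf (x ∷ l@(_ ∷ _)) u@(_ ∷ ul) _ =
    let (t , v , t↭) = treeOf l ul λ ()
        (t′ , v′ , t′↭) = insert x t v λ x∈t → Unique.Unique[x∷xs]⇒x∉xs u (∈-resp-↭ t↭ x∈t)
    in t′ , v′ , ↭-trans t′↭ (prep x t↭)

  -- Uniqueness of the tree, and its labels

  same-root : ∀ α (p q : Tree K A) β (p′ q′ : Tree K A) → Valid (node α p q) → Valid (node β p′ q′) →
              (∀ {x} → x ∈ leaves (node α p q) → x ∈ leaves (node β p′ q′)) → ¬ α < β
  same-root α p q β p′ q′ (_ , _ , pq) v′ sub α<β =
    let (x , x∈p) = some-leaf p
        (z , z∈q) = some-leaf q
        (_ , x0 , z1) = pq x∈p z∈q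
        -- Below β all leaves of the second tree agree, yet `x` and `z` are split at α.
        x≡z = agree {p = p′} {q = q′} v′ (sub (∈-++⁺ˡ x∈p)) (sub (∈-++⁺ʳ (leaves p) z∈q)) α α<β
    in contradiction (trans (sym x0) (trans x≡z z1)) λ ()

  leaf≢node : ∀ α (p q : Tree K A) → Valid (node α p q) →
              ¬ (∀ {y} → y ∈ leaves (node α p q) → y ∈ x ∷ [])
  leaf≢node α p q (_ , _ , pq) sub
    with some-leaf p | some-leaf q
  ... | y , y∈p | z , z∈q with sub (∈-++⁺ˡ y∈p) | sub (∈-++⁺ʳ (leaves p) z∈q)
  ... | here refl | here refl = D-irrefl (split⇒D (pq y∈p z∈q))

  -- The root label is the least level at which leaves differ, and the value there tells the two
  -- sides apart. Hence a colour computed from the tree depends on the set alone.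
  valid-unique : ∀ t t′ → Valid t → Valid t′ → (∀ {x} → x ∈ leaves t → x ∈ leaves t′) →
                 (∀ {x} → x ∈ leaves t′ → x ∈ leaves t) → t ≡ t′
  valid-unique (leaf x) (leaf y) _ _ sub _ with sub (here refl)
  ... | here refl = refl
  valid-unique (leaf x) (node β p q) _ v _ sup = ⊥-elim (leaf≢node β p q v sup)
  valid-unique (node α p q) (leaf y) v _ sub _ = ⊥-elim (leaf≢node α p q v sub)
  valid-unique (node α p q) (node β p′ q′) v@(vp , vq , pq) v′@(vp′ , vq′ , pq′) sub sup
    with compare α β
  ... | tri< α<β _ _ = contradiction α<β (same-root α p q β p′ q′ v v′ sub)
  ... | tri> _ _ β<α = contradiction β<α (same-root β p′ q′ α p q v′ v sup)
  ... | tri≈ _ refl _ =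
    cong₂ (node α)
      (valid-unique p p′ vp vp′ (left p′ q′ is-0 is-1′ sub) (left p q is-0′ is-1 sup))
      (valid-unique q q′ vq vq′ (right p′ q′ is-1 is-0′ sub) (right p q is-1′ is-0 sup))
    where
    is-0 : x ∈ leaves p → x α ≡ 0₂
    is-0 x∈p = proj₁ (proj₂ (pq x∈p (proj₂ (some-leaf q))))
    is-1 : x ∈ leaves q → x α ≡ 1₂
    is-1 x∈q = proj₂ (proj₂ (pq (proj₂ (some-leaf p)) x∈q))
    is-0′ : x ∈ leaves p′ → x α ≡ 0₂
    is-0′ x∈p = proj₁ (proj₂ (pq′ x∈p (proj₂ (some-leaf q′))))
    is-1′ : x ∈ leaves q′ → x α ≡ 1₂
    is-1′ x∈q = proj₂ (proj₂ (pq′ (proj₂ (some-leaf p′)) x∈q))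
    left : ∀ {l k} (r s : Tree K A) → (∀ {x} → x ∈ l → x α ≡ 0₂) → (∀ {x} → x ∈ leaves s → x α ≡ 1₂) →
           (∀ {x} → x ∈ l ++ k → x ∈ leaves r ++ leaves s) → x ∈ l → x ∈ leaves r
    left r s l0 s1 sub x∈l with ∈-++⁻ (leaves r) (sub (∈-++⁺ˡ x∈l))
    ... | inj₁ x∈r = x∈r
    ... | inj₂ x∈s = contradiction (trans (sym (l0 x∈l)) (s1 x∈s)) λ ()
    right : ∀ {l k} (r s : Tree K A) → (∀ {x} → x ∈ k → x α ≡ 1₂) → (∀ {x} → x ∈ leaves r → x α ≡ 0₂) →
            (∀ {x} → x ∈ l ++ k → x ∈ leaves r ++ leaves s) → x ∈ k → x ∈ leaves s
    right {l = l} r s k1 r0 sub x∈k with ∈-++⁻ (leaves r) (sub (∈-++⁺ʳ l x∈k))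
    ... | inj₁ x∈r = contradiction (trans (sym (r0 x∈r)) (k1 x∈k)) λ ()
    ... | inj₂ x∈s = x∈s

  -- Together with `D⇒labels`: the labels are exactly the values of δ on the leaves.
  labels⇒D : ∀ t → Valid t → α ∈ labels t → ∃[ x ] ∃[ y ] x ∈ leaves t × y ∈ leaves t × D α x y
  labels⇒D (node α p q) (vp , vq , pq) (here refl) =
    let (x , x∈p) = some-leaf p
        (y , y∈q) = some-leaf q
    in x , y , ∈-++⁺ˡ x∈p , ∈-++⁺ʳ (leaves p) y∈q , split⇒D (pq x∈p y∈q)
  labels⇒D (node α p q) (vp , vq , pq) (there α∈) with ∈-++⁻ (labels p) α∈
  ... | inj₁ α∈p = let (x , y , x∈p , y∈p , d) = labels⇒D p vp α∈p in
                   x , y , ∈-++⁺ˡ x∈p , ∈-++⁺ˡ y∈p , d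
  ... | inj₂ α∈q = let (x , y , x∈q , y∈q , d) = labels⇒D q vq α∈q in
                   x , y , ∈-++⁺ʳ (leaves p) x∈q , ∈-++⁺ʳ (leaves p) y∈q , d

  D⇒labels : ∀ t → Valid t → x ∈ leaves t → y ∈ leaves t → D α x y → α ∈ labels t
  D⇒labels (leaf _) _ (here refl) (here refl) d = contradiction d D-irrefl
  D⇒labels (node β p q) (vp , vq , pq) x∈t y∈t d with ∈-++⁻ (leaves p) x∈t | ∈-++⁻ (leaves p) y∈t
  ... | inj₁ x∈p | inj₁ y∈p = there (∈-++⁺ˡ (D⇒labels p vp x∈p y∈p d))
  ... | inj₂ x∈q | inj₂ y∈q = there (∈-++⁺ʳ (labels p) (D⇒labels q vq x∈q y∈q d))
  ... | inj₁ x∈p | inj₂ y∈q = here (D-unique d (split⇒D (pq x∈p y∈q)))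
  ... | inj₂ x∈q | inj₁ y∈p = here (D-unique (D-sym d) (split⇒D (pq y∈p x∈q)))

  -- If the root label recurred further down, two leaves there and the leaf split off at the root
  -- would pairwise have the same first difference. So δ takes as many values as the tree has nodes.
  labels-unique : ∀ t → Valid t → Caterpillar t → Unique (labels t)
  labels-unique (leaf _) _ _ = []
  labels-unique (node α (leaf _) q) (_ , vq , pq) (nodeˡ c) =
    All.tabulate (λ β∈q → λ { refl →
      let (x , y , x∈q , y∈q , d) = labels⇒D q vq β∈q
      in D-triangle (D-sym (split⇒D (pq (here refl) x∈q))) (split⇒D (pq (here refl) y∈q)) d })
    ∷ labels-unique q vq c
  labels-unique (node α p (leaf z)) (vp , _ , pq) (nodeʳ c) =
    All.tabulate (λ β∈ → λ { refl → [ (λ β∈p →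
      let (x , y , x∈p , y∈p , d) = labels⇒D p vp β∈p
      in D-triangle (split⇒D (pq x∈p (here refl))) (D-sym (split⇒D (pq y∈p (here refl)))) d) , (λ ()) ]
      (∈-++⁻ (labels p) β∈) })
    ∷ Unique.++⁺ (labels-unique p vp c) [] λ ()

  -- Deletions and forks in valid trees

  ⊏-leaves : ∀ {t′ t : Tree K A} → t′ ⊏ t → x ∈ leaves t′ → x ∈ leaves t
  ⊏-leaves dropˡ x∈ = there x∈
  ⊏-leaves dropʳ x∈ = ∈-++⁺ˡ x∈
  ⊏-leaves {t′ = node _ p′ q} {t = node _ p _} (inˡ d) x∈ with ∈-++⁻ (leaves p′) x∈
  ... | inj₁ x∈p = ∈-++⁺ˡ (⊏-leaves d x∈p)
  ... | inj₂ x∈q = ∈-++⁺ʳ (leaves p) x∈q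
  ⊏-leaves {t′ = node _ p q′} (inʳ d) x∈ with ∈-++⁻ (leaves p) x∈
  ... | inj₁ x∈p = ∈-++⁺ˡ x∈p
  ... | inj₂ x∈q = ∈-++⁺ʳ (leaves p) (⊏-leaves d x∈q)

  ⊏-valid : ∀ {t′ t} → t′ ⊏ t → Valid t → Valid t′
  ⊏-valid dropˡ (_ , vq , _) = vq
  ⊏-valid dropʳ (vp , _ , _) = vp
  ⊏-valid (inˡ d) (vp , vq , pq) = ⊏-valid d vp , vq , λ y∈p → pq (⊏-leaves d y∈p)
  ⊏-valid (inʳ d) (vp , vq , pq) = vp , ⊏-valid d vq , λ y∈p z∈q → pq y∈p (⊏-leaves d z∈q)

  two-leaves : ∀ β p q → Valid (node β p q) →
               ∃[ x ] ∃[ y ] x ∈ leaves (node β p q) × y ∈ leaves (node β p q) × x ≢ y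
  two-leaves β p q (_ , _ , pq) =
    let (x , x∈p) = some-leaf p
        (y , y∈q) = some-leaf q
    in x , y , ∈-++⁺ˡ x∈p , ∈-++⁺ʳ (leaves p) y∈q , D⇒≢ (split⇒D (pq x∈p y∈q))

  -- A node with nodes on both sides has two leaves on either side, which form a fork at its label.
  fork-free⇒caterpillar : ∀ t → Valid t → ForkFree (_∈ leaves t) → Caterpillar t
  fork-free⇒caterpillar (leaf _) _ _ = leaf
  fork-free⇒caterpillar (node α (leaf _) q) (_ , vq , _) ff =
    nodeˡ (fork-free⇒caterpillar q vq λ x∈ u∈ z∈ v∈ → ff (there x∈) (there u∈) (there z∈) (there v∈))
  fork-free⇒caterpillar (node α p@(node _ _ _) (leaf _)) (vp , _ , _) ff =
    nodeʳ (fork-free⇒caterpillar p vp λ x∈ u∈ z∈ v∈ →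
      ff (∈-++⁺ˡ x∈) (∈-++⁺ˡ u∈) (∈-++⁺ˡ z∈) (∈-++⁺ˡ v∈))
  fork-free⇒caterpillar (node α p@(node β p₁ p₂) q@(node γ q₁ q₂)) (vp , vq , pq) ff =
    let (x , u , x∈ , u∈ , x≢u) = two-leaves β p₁ p₂ vp
        (z , v , z∈ , v∈ , z≢v) = two-leaves γ q₁ q₂ vq
        d : ∀ {y w} → y ∈ leaves p → w ∈ leaves q → D α y w
        d y∈ w∈ = split⇒D (pq y∈ w∈)
    in ⊥-elim (ff (∈-++⁺ˡ x∈) (∈-++⁺ˡ u∈) (∈-++⁺ʳ (leaves p) z∈) (∈-++⁺ʳ (leaves p) v∈)
              x≢u z≢v (d x∈ z∈) (d x∈ v∈) (d u∈ z∈) (d u∈ v∈))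

  -- Of four leaves forming a fork, none can be the one split off at the root.
  lonely : (∀ {y} → y ∈ leaves q → D β w y) → x ∈ w ∷ leaves q → u ∈ w ∷ leaves q → z ∈ w ∷ leaves q →
           x ≢ u → D α x z → D α u z → x ∈ leaves q
  lonely sep (there x∈) _ _ _ _ _ = x∈
  lonely sep (here refl) (here refl) _ x≢u _ _ = contradiction refl x≢u
  lonely sep (here refl) (there u∈) (here refl) _ xz _ = contradiction xz D-irrefl
  lonely sep (here refl) (there u∈) (there z∈) _ xz uz with D-unique xz (sep z∈)
  ... | refl = ⊥-elim (D-triangle (sep u∈) uz xz)

  -- `lonely`, applied to each of the four points in turn, places the whole fork in `q`.
  lonely-fork : (∀ {y} → y ∈ leaves q → D β w y) → ForkFree (_∈ leaves q) → ForkFree (_∈ w ∷ leaves q)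
  lonely-fork {q = q} sep ff x∈ u∈ z∈ v∈ x≢u z≢v xz xv uz uv =
    ff (lonely {q = q} sep x∈ u∈ z∈ x≢u xz uz)
       (lonely {q = q} sep u∈ x∈ z∈ (≢-sym x≢u) uz xz)
       (lonely {q = q} sep z∈ v∈ x∈ z≢v (D-sym xz) (D-sym xv))
       (lonely {q = q} sep v∈ z∈ x∈ (≢-sym z≢v) (D-sym xv) (D-sym xz))
       x≢u z≢v xz xv uz uv

  caterpillar⇒fork-free : ∀ t → Valid t → Caterpillar t → ForkFree (_∈ leaves t)
  caterpillar⇒fork-free (leaf _) _ _ (here refl) (here refl) _ _ x≢u _ _ _ _ _ = x≢u refl
  caterpillar⇒fork-free (node β (leaf w) q) (_ , vq , pq) (nodeˡ c) =
    lonely-fork {q = q} (λ y∈q → split⇒D (pq (here refl) y∈q)) (caterpillar⇒fork-free q vq c)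
  caterpillar⇒fork-free (node β p (leaf w)) (vp , _ , pq) (nodeʳ c) x∈ u∈ z∈ v∈ =
    lonely-fork {q = p} (λ y∈p → D-sym (split⇒D (pq y∈p (here refl)))) (caterpillar⇒fork-free p vp c)
      (swap x∈) (swap u∈) (swap z∈) (swap v∈)
    where
    swap : y ∈ leaves p ++ w ∷ [] → y ∈ w ∷ leaves p
    swap = ∈-resp-↭ (++-comm (leaves p) (w ∷ []))

  -- Choosing levels in a fork-free set

  module _ {X : A → Set ℓ} (fork-free : ForkFree X) where

    private
      -- As X is fork-free, x is then the only element of X on its side of the split at α.
      Alone : K → A → Set ℓ
      Alone α x = ∃[ u ] ∃[ v ] X u × X v × u ≢ v × D α x u × D α x v

      -- Distinct members split from a central point at distinct levels, so one such point yields
      -- all the levels wanted.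
      Central : A → Set ℓ
      Central z = ∀ α x u → X x → X u → D α x z → D α u z → x ≡ u

      no-central : ¬ (∃[ z ] X z × Central z) → X x → ∃[ α ] Alone α x
      no-central {x} none Xx = decidable-stable em λ ¬alone →
        none (x , Xx , λ α u v Xu Xv ux vx → decidable-stable em λ u≢v →
          ¬alone (α , u , v , Xu , Xv , u≢v , D-sym ux , D-sym vx))

      -- Every position of γ gives a fork. For γ < α it separates `x`, `u` from `y`, `u′`; for γ =
      -- α, `u′`, `v′` from `u`, `v`; for γ > α, `x`, `y` from `u`, `v`.
      alone-unsplit : X x → X y → Alone α x → Alone α y → ¬ D γ x y
      alone-unsplit {x} {y} {α} {γ} Xx Xy (u , v , Xu , Xv , u≢v , xu , xv)
                    (u′ , v′ , Xu′ , Xv′ , u′≢v′ , yu′ , yv′) xy with compare γ α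
      ... | tri< γ<α _ _ = fork-free Xx Xu Xy Xu′ (D⇒≢ xu) (D⇒≢ yu′) xy xu″ uy (D-step uy γ<α (proj₁ yu′))
        where
        xu″ = D-step xy γ<α (proj₁ yu′)
        uy = D-sym (D-step (D-sym xy) γ<α (proj₁ xu))
      ... | tri≈ _ refl _ = fork-free Xu′ Xv′ Xu Xv u′≢v′ u≢v
              (D-path (D-sym yu′) (D-sym xy) xu) (D-path (D-sym yu′) (D-sym xy) xv)
              (D-path (D-sym yv′) (D-sym xy) xu) (D-path (D-sym yv′) (D-sym xy) xv)
      ... | tri> _ _ α<γ = fork-free Xx Xy Xu Xv (D⇒≢ xy) u≢v xu xv (slide xu) (slide xv)
        where
        slide : D α x w → D α y w
        slide xw = D-sym (D-step (D-sym xw) α<γ (proj₁ xy))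

      alone-injective : X x → X y → Alone α x → Alone α y → x ≡ y
      alone-injective Xx Xy ax ay = decidable-stable em λ x≢y →
        alone-unsplit Xx Xy ax ay (proj₂ (differ x≢y))

      -- If z fails to split from x at α then it can be replaced by u without harm to the others.
      recentre : X x → X z → (α,x : Alone α x) → ¬ D α x z →
                 ∀ {β y} → X y → Alone β y → D β y z → D β y (proj₁ α,x)
      recentre {x} {z} {α} Xx Xz a@(u , v , Xu , Xv , u≢v , xu , xv) ¬xz {β} {y} Xy
               b@(u′ , v′ , Xu′ , Xv′ , u′≢v′ , yu′ , yv′) yz with em {P = x ≡ z}
      ... | yes refl with compare β α
      ...   | tri< β<α _ _ = D-step yz β<α (proj₁ xu)
      ...   | tri≈ _ refl _ = contradiction yz (alone-unsplit Xy Xx b a)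
      ...   | tri> _ _ α<β = ⊥-elim (fork-free Xx Xy Xu Xv (≢-sym (D⇒≢ yz)) u≢v xu xv
              (D-sym (D-step (D-sym xu) α<β (proj₁ (D-sym yz))))
              (D-sym (D-step (D-sym xv) α<β (proj₁ (D-sym yz)))))
      recentre {x} {z} {α} Xx Xz a@(u , v , Xu , Xv , u≢v , xu , xv) ¬xz {β} {y} Xy
               b@(u′ , v′ , Xu′ , Xv′ , u′≢v′ , yu′ , yv′) yz | no x≢z with differ x≢z
      -- For γ > α, `x` and `z` form a fork with `u` and `v`. For γ < α, `x` and `u` leave `z`
      -- together at γ, and β must lie below γ: if β = γ, then `x`, `u` are opposite `u′`, `v′`, and
      -- if β > γ, then `y`, `z` are opposite `x`, `u`.
      ... | γ , xz with compare γ α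
      ...   | tri≈ _ refl _ = contradiction xz ¬xz
      ...   | tri> _ _ α<γ = ⊥-elim (fork-free Xx Xz Xu Xv x≢z u≢v xu xv
              (D-sym (D-step (D-sym xu) α<γ (proj₁ xz)))
              (D-sym (D-step (D-sym xv) α<γ (proj₁ xz))))
      ...   | tri< γ<α _ _ with compare β γ
      ...     | tri< β<γ _ _ = D-step yz β<γ (Agree-sym (proj₁ uz))
        where uz = D-sym (D-step (D-sym xz) γ<α (proj₁ xu))
      ...     | tri≈ _ refl _ = ⊥-elim (fork-free Xx Xu Xu′ Xv′ (D⇒≢ xu) u′≢v′
                (D-path xz (D-sym yz) yu′) (D-path xz (D-sym yz) yv′)
                (D-path uz (D-sym yz) yu′) (D-path uz (D-sym yz) yv′))
        where uz = D-sym (D-step (D-sym xz) γ<α (proj₁ xu))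
      ...     | tri> _ _ γ<β = ⊥-elim (fork-free Xy Xz Xx Xu (D⇒≢ yz) (D⇒≢ xu)
                (slide (D-sym xz)) (slide zu) (D-sym xz) zu)
        where
        zu = D-step (D-sym xz) γ<α (proj₁ xu)
        slide : D γ z w → D γ y w
        slide zw = D-sym (D-step (D-sym zw) γ<β (proj₁ (D-sym yz)))

    -- The levels will form the set monochromatic under `f`. The point in `beyond` may depend on the
    -- finite list, since without a central point it has to be moved along.
    record Spine (Λ : Set ℓ) : Set ℓ where
      field
        level           : Λ → K
        branch          : Λ → A
        level-injective : ∀ {i j} → level i ≡ level j → i ≡ j
        branch∈X        : ∀ i → X (branch i)
        beyond          : ∀ l → ∃[ z ] X z × (∀ {i} → i ∈ l → D (level i) (branch i) z)

    module _ {Λ : Set ℓ} (φ : Λ → A) (φ-injective : ∀ {i j} → φ i ≡ φ j → i ≡ j)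
             (φ∈X : ∀ i → X (φ i)) {x₀ : A} (Xx₀ : X x₀) (φ≢x₀ : ∀ i → φ i ≢ x₀) where

      private
        central-spine : X z → Central z → Spine Λ
        central-spine {z} Xz central = record
          { level           = λ i → proj₁ (level i)
          ; branch          = λ i → ψ i em
          ; level-injective = λ {i} {j} eq → ψ-injective em em
              (central _ _ _ (ψ∈X i em) (ψ∈X j em) (proj₂ (level i))
                (subst (λ α → D α (ψ j em) z) (sym eq) (proj₂ (level j))))
          ; branch∈X        = λ i → ψ∈X i em
          ; beyond          = λ _ → z , Xz , λ {i} _ → proj₂ (level i)
          }
          where
          -- The centre cannot split from itself; if it is among the values of `φ`, the spare point
          -- `x₀` takes its place.
          ψ : ∀ i → Dec (φ i ≡ z) → A
          ψ i (yes _) = x₀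
          ψ i (no _)  = φ i
          ψ∈X : ∀ i d → X (ψ i d)
          ψ∈X i (yes _) = Xx₀
          ψ∈X i (no _)  = φ∈X i
          ψ≢z : ∀ i d → ψ i d ≢ z
          ψ≢z i (yes φi≡z) x₀≡z = φ≢x₀ i (trans φi≡z (sym x₀≡z))
          ψ≢z i (no φi≢z)  = φi≢z
          ψ-injective : ∀ {i j} d e → ψ i d ≡ ψ j e → i ≡ j
          ψ-injective (yes p) (yes q) _  = φ-injective (trans p (sym q))
          ψ-injective (yes _) (no _)  eq = contradiction (sym eq) (φ≢x₀ _)
          ψ-injective (no _)  (yes _) eq = contradiction eq (φ≢x₀ _)
          ψ-injective (no _)  (no _)  eq = φ-injective eq
          level : ∀ i → ∃[ α ] D α (ψ i em) z
          level i = differ (ψ≢z i em)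

        endless-spine : (∀ {x} → X x → ∃[ α ] Alone α x) → Spine Λ
        endless-spine alone = record
          { level           = λ i → proj₁ (alone (φ∈X i))
          ; branch          = φ
          ; level-injective = λ {i} {j} eq → φ-injective (alone-injective (φ∈X i) (φ∈X j)
              (proj₂ (alone (φ∈X i))) (subst (λ α → Alone α (φ j)) (sym eq) (proj₂ (alone (φ∈X j)))))
          ; branch∈X        = φ∈X
          ; beyond          = beyond
          }
          where
          beyond : ∀ l → ∃[ z ] X z × (∀ {i} → i ∈ l → D (proj₁ (alone (φ∈X i))) (φ i) z)
          beyond [] = x₀ , Xx₀ , λ ()
          beyond (i ∷ l) with beyond l
          ... | z , Xz , all with em {P = D (proj₁ (alone (φ∈X i))) (φ i) z}
          ...   | yes d = z , Xz , λ { (here refl) → d ; (there j∈l) → all j∈l }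
          -- The point moves across the split at the level of `i`, to a witness `u` that `φ i` is
          -- alone; `recentre` preserves the splits obtained so far.
          ...   | no ¬d = let a = proj₂ (alone (φ∈X i)); (u , _ , Xu , _ , _ , iu , _) = a in
            u , Xu , λ { (here refl) → iu
                       ; {j} (there j∈l) → recentre (φ∈X i) Xz a ¬d (φ∈X j) (proj₂ (alone (φ∈X j))) (all j∈l) }

      spine : Spine Λ
      spine with em {P = ∃[ z ] X z × Central z}
      ... | yes (z , Xz , central) = central-spine Xz central
      ... | no none = endless-spine (no-central none)

-- Lists and finite subsets

module _ {ℓ} {A : Set ℓ} where

  index-∈-lookup : ∀ (l : List A) i → index (∈-lookup {xs = l} i) ≡ i
  index-∈-lookup (_ ∷ _) zero    = refl
  index-∈-lookup (_ ∷ l) (suc i) = cong suc (index-∈-lookup l i)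

  listed : ∀ {n} l → Unique l → length l ≡ n → Setoid.Carrier (A choose n)
  listed l u eq = record { Member = _∈ l ; irrelevant = unique⇒irrelevant u } ,
    subst (λ n → ∃ (_∈ l) ↔ finite n) eq (mk↔ₛ′
      (λ (_ , x∈l) → lift (index x∈l))
      (λ (lift i) → lookup l i , ∈-lookup i)
      (λ (lift i) → cong lift (index-∈-lookup l i))
      (λ (x , x∈l) → Σ-≡ (sym (lookup-index x∈l))))
    where
    Σ-≡ : ∀ {x y} {p : x ∈ l} {q : y ∈ l} → x ≡ y → (x , p) ≡ (y , q)
    Σ-≡ {x} {p = p} {q} refl = cong (x ,_) (unique⇒irrelevant u p q)

  record Listing (P : A → Set ℓ) (n : ℕ) : Set ℓ where
    field
      list     : List A
      unique   : Unique list
      length≡n : length list ≡ n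
      sound    : ∀ {x} → x ∈ list → P x
      complete : ∀ {x} → P x → x ∈ list

  listing : ∀ {n} (T : Subset A) → HasCardinality T (finite n) → Listing (Member T) n
  listing T T↔n = record
    { list     = tabulate enum
    ; unique   = Unique.tabulate⁺ λ eq → cong lower (from-injective (Σ-≡ eq))
    ; length≡n = length-tabulate enum
    ; sound    = λ x∈ → let (i , eq) = ∈-tabulate⁻ x∈ in
                 subst (Member T) (sym eq) (proj₂ (from (lift i)))
    ; complete = λ {x} x∈T → subst (_∈ tabulate enum) (cong proj₁ (strictlyInverseʳ (x , x∈T)))
                   (∈-tabulate⁺ (lower (to (x , x∈T))))
    }
    where
    open Inverse T↔n
    enum : Fin _ → A
    enum i = proj₁ (from (lift i))
    Σ-≡ : ∀ {p q : ∃ (Member T)} → proj₁ p ≡ proj₁ q → p ≡ q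
    Σ-≡ {x , _} refl = cong (x ,_) (Subset.irrelevant T _ _)
    from-injective : ∀ {i j} → from i ≡ from j → i ≡ j
    from-injective {i} {j} eq =
      trans (sym (strictlyInverseˡ i)) (trans (cong to eq) (strictlyInverseˡ j))

  unique-⊆⇒≤ : ∀ {xs ys : List A} → Unique xs → (∀ {x} → x ∈ xs → x ∈ ys) → length xs ≤ length ys
  unique-⊆⇒≤ [] _ = z≤n
  unique-⊆⇒≤ {x ∷ xs} (x∉xs ∷ u) sub with ∈-∃++ (sub (here refl))
  ... | as , bs , refl =
    ≤-trans (s≤s (unique-⊆⇒≤ u rest)) (≤-reflexive (sym (↭-length (shift x as bs))))
    where
    rest : ∀ {y} → y ∈ xs → y ∈ as ++ bs
    rest y∈xs with ∈-resp-↭ (shift x as bs) (sub (there y∈xs))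
    ... | here refl = contradiction refl (All.lookup x∉xs y∈xs)
    ... | there y∈  = y∈

  record Sample (X : A → Set ℓ) (n : ℕ) : Set ℓ where
    field
      list     : List A
      unique   : Unique list
      length≡n : length list ≡ n
      inside   : ∀ {x} → x ∈ list → X x

module _ (em : ∀ {a} → ExcludedMiddle a) {ℓ} {A : Set ℓ} {X : A → Set ℓ} where

  -- As long as `l` is shorter than the sample, the sample has a point outside `l` that can be
  -- added.
  extend : ∀ {n} → Sample X n → ∀ k l → Unique l → (∀ {x} → x ∈ l → X x) → k + length l ≡ n →
           ∃[ S ] (∀ {x} → x ∈ l → x ∈ Sample.list {X = X} {n} S)
  extend _ zero l u l⊆X eq = record { list = l ; unique = u ; length≡n = eq ; inside = l⊆X } , λ x∈ → x∈
  extend S (suc k) l u l⊆X eq =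
    let (S′ , sub) = extend S k (x ∷ l) (All.tabulate (λ y∈l x≡y → x∉l (subst (_∈ l) (sym x≡y) y∈l)) ∷ u)
                       (λ { (here refl) → S.inside x∈S ; (there y∈l) → l⊆X y∈l })
                       (trans (+-suc k (length l)) eq)
    in S′ , λ y∈l → sub (there y∈l)
    where
    module S = Sample S
    fresh : ∃[ x ] x ∈ S.list × x ∉ l
    fresh = decidable-stable em λ none → <⇒≱
      (≤-trans (s≤s (m≤n+m (length l) k)) (≤-reflexive (trans eq (sym S.length≡n))))
      (unique-⊆⇒≤ S.unique λ {x} x∈S → decidable-stable em λ x∉l → none (x , x∈S , x∉l))
    x = proj₁ fresh
    x∈S = proj₁ (proj₂ fresh)
    x∉l = proj₂ (proj₂ fresh)

-- The colouring

-- The value of `η` with its two tests abstracted, so that colours can be defined by matching on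
-- their results.
η-if : Bool → Bool → ℕ
η-if b c = if b then 1 else if c then 2 else 3

-- For `b = true`, the case r = 3, both parities share the only extra colour.
encode : ∀ b c → Bool → Fin (η-if b c)
encode true  _     _     = zero
encode false true  false = zero
encode false true  true  = suc zero
encode false false false = zero
encode false false true  = suc zero

encode-injective : ∀ b c {x y} → b ≡ false → encode b c x ≡ encode b c y → x ≡ y
encode-injective false true  {false} {false} _ _ = refl
encode-injective false true  {true}  {true}  _ _ = refl
encode-injective false false {false} {false} _ _ = refl
encode-injective false false {true}  {true}  _ _ = refl

module SteppingUp (em : ∀ {a} → ExcludedMiddle a) (ext : ∀ {a b} → Extensionality a b)
                  {ℓ} (r : ℕ) (3≤r : 3 ≤ r) (κ : Set ℓ) {C : Set ℓ} (c₀ : C) (f : Colouring κ r C) where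

  wo = Zermelo.wellOrdering em ext κ
  open WellOrdering wo using (compare)
  open Levels em ext wo

  extraColour : Bool → Fin (η r)
  extraColour = encode (does (r ≟ 3)) (does (2 ∣? r))

  -- The default `c₀` is for lists that do not enumerate an r-set; the labels of a valid caterpillar
  -- with r + 1 leaves always do.
  labelColour : List κ → C
  labelColour l with em {P = Σ[ u ∈ Unique l ] length l ≡ r}
  ... | yes (u , eq) = Func.to f (listed l u eq)
  ... | no _         = c₀

  labelColour-≐ : ∀ {l} → Unique l → length l ≡ r → (T : Setoid.Carrier (κ choose r)) →
                  (∀ {α} → α ∈ l → Member (proj₁ T) α) → (∀ {α} → Member (proj₁ T) α → α ∈ l) →
                  labelColour l ≡ Func.to f T
  labelColour-≐ {l} u eq T sub sup with em {P = Σ[ u ∈ Unique l ] length l ≡ r}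
  ... | yes _  = Func.cong f (sub , sup)
  ... | no ¬ul = contradiction (u , eq) ¬ul

  colourBy : Class → Tree κ A → C ⊎ Fin (η r)
  colourBy chain     t = inj₁ (labelColour (labels t))
  colourBy spare     t = inj₁ c₀
  colourBy (extra b) t = inj₂ (extraColour b)

  colour : Tree κ A → C ⊎ Fin (η r)
  colour t = colourBy (class t) t

  -- A separate `n` serves for `r + 1`, which does not reduce to `suc r`.
  module _ {n} (n≡1+r : n ≡ suc r) where

    treeFor : (T : Setoid.Carrier (A choose n)) →
              ∃[ t ] Valid t × (∀ {x} → x ∈ leaves t → Member (proj₁ T) x) ×
                               (∀ {x} → Member (proj₁ T) x → x ∈ leaves t)
    treeFor (T , T↔n) =
      let open Listing (listing T T↔n)
          (t , v , t↭) = treeOf list unique λ eq → contradiction (trans (sym eq) (trans length≡n n≡1+r)) λ ()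
      in t , v , (λ x∈t → sound (∈-resp-↭ t↭ x∈t)) , λ x∈T → ∈-resp-↭ (↭-sym t↭) (complete x∈T)

    stepUp : Colouring A n (C ⊎ Fin (η r))
    stepUp = record
      { to   = λ T → colour (proj₁ (treeFor T))
      ; cong = λ {S} {T} (S⊆T , T⊆S) →
          let (s , vs , s-sound , s-complete) = treeFor S
              (t , vt , t-sound , t-complete) = treeFor T
          in cong colour (valid-unique s t vs vt (λ x∈s → t-complete (S⊆T (s-sound x∈s)))
                                                 (λ x∈t → s-complete (T⊆S (t-sound x∈t))))
      }

    -- Monochromatic sets of the new colouring

    module _ {X : Subset A} {c : C ⊎ Fin (η r)} (mono : Monochromatic stepUp c X) where

      -- By uniqueness, `t` is the tree that `treeFor` finds for its set of leaves.
      tree-colour : ∀ t → Valid t → size t ≡ n → (∀ {x} → x ∈ leaves t → Member X x) → colour t ≡ c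
      tree-colour t v eq t⊆X =
        let T = listed (leaves t) (leaves-unique t v) (trans (length-leaves t) eq)
            (t′ , v′ , sound , complete) = treeFor T
        in trans (cong colour (valid-unique t t′ v v′ complete sound)) (mono T t⊆X)

      ⊏-colour : ∀ {t′ t} → t′ ⊏ t → Valid t → size t ≡ suc n → (∀ {x} → x ∈ leaves t → Member X x) →
                 colour t′ ≡ c
      ⊏-colour {t′} d v eq t⊆X =
        tree-colour t′ (⊏-valid d v) (suc-injective (trans (sym (size-⊏ d)) eq)) λ x∈ → t⊆X (⊏-leaves d x∈)

    5≤ : 5 ≤ suc n
    5≤ = s≤s (≤-trans (s≤s 3≤r) (≤-reflexive (sym n≡1+r)))

    sample-tree : ∀ {X : A → Set ℓ} (S : Sample X (suc n)) →
                  ∃[ t ] Valid t × leaves t ↭ Sample.list S × size t ≡ suc n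
    sample-tree S =
      let open Sample S
          (t , v , t↭) = treeOf list unique λ eq → contradiction (trans (sym length≡n) eq) λ ()
      in t , v , t↭ , trans (sym (length-leaves t)) (trans (↭-length t↭) length≡n)

    -- Any other tree with r + 2 leaves has a one-leaf deletion in an extra colour.
    inj₁-caterpillar : ∀ {X ξ} → Monochromatic stepUp (inj₁ ξ) X → ∀ t → Valid t → size t ≡ suc n →
                       (∀ {x} → x ∈ leaves t → Member X x) → Caterpillar t
    inj₁-caterpillar {X} mono t v eq t⊆X = kind⇒caterpillar t (decidable-stable em λ ≢cat →
      let (b , (t′ , d , extra-b) , _) = separated t (≤-trans 5≤ (≤-reflexive (sym eq))) ≢cat
      in contradiction (trans (sym (cong (λ k → colourBy k t′) extra-b)) (⊏-colour {X = X} mono d v eq t⊆X)) λ ())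

    -- A fork could be completed to an (r + 2)-subset of `X`, whose tree is a caterpillar and so has
    -- no fork.
    inj₁-fork-free : ∀ {X ξ} → Monochromatic stepUp (inj₁ ξ) X → Sample (Member X) (suc n) →
                     ForkFree (Member X)
    inj₁-fork-free {X} mono S {x = x} {u} {z} {v} Xx Xu Xz Xv x≢u z≢v xz xv uz uv =
      let (S′ , sub) = extend em S (suc n ∸ 4) (x ∷ u ∷ z ∷ v ∷ [])
            ((x≢u ∷ D⇒≢ xz ∷ D⇒≢ xv ∷ []) ∷ (D⇒≢ uz ∷ D⇒≢ uv ∷ []) ∷ (z≢v ∷ []) ∷ [] ∷ [])
            (λ { (here refl) → Xx ; (there (here refl)) → Xu ; (there (there (here refl))) → Xz
               ; (there (there (there (here refl)))) → Xv })
            (m∸n+n≡m (≤-trans (n≤1+n 4) 5≤))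
          (t , vt , t↭ , eq) = sample-tree S′
          cat = inj₁-caterpillar {X} mono t vt eq λ x∈t → Sample.inside S′ (∈-resp-↭ t↭ x∈t)
          in-t : ∀ {y} → y ∈ x ∷ u ∷ z ∷ v ∷ [] → y ∈ leaves t
          in-t y∈ = ∈-resp-↭ (↭-sym t↭) (sub y∈)
      in caterpillar⇒fork-free t vt cat (in-t (here refl)) (in-t (there (here refl)))
           (in-t (there (there (here refl)))) (in-t (there (there (there (here refl)))))
           x≢u z≢v xz xv uz uv

    -- For r = 3 the colour does not show the parity, but by `extra-4` only one parity occurs.
    extraColour-injective : ∀ (s t : Tree κ A) {b b′} → size s ≡ n → size t ≡ n → class s ≡ extra b → class t ≡ extra b′ →
                            extraColour b ≡ extraColour b′ → b ≡ b′
    extraColour-injective s t s-size t-size s-class t-class eq with r ≟ 3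
    ... | yes refl = trans (extra-4 s (trans s-size n≡1+r) s-class)
                           (sym (extra-4 t (trans t-size n≡1+r) t-class))
    ... | no r≢3 = encode-injective (does (r ≟ 3)) (does (2 ∣? r)) (dec-false (r ≟ 3) r≢3) eq

    -- A caterpillar has a deletion that is a caterpillar, hence coloured in τ. Any other tree is
    -- separated, and its two deletions cannot share an extra colour.
    inj₂-bounded : ∀ {X j} → Monochromatic stepUp (inj₂ j) X → ¬ Sample (Member X) (suc n)
    inj₂-bounded {X} {j} mono S with sample-tree S
    ... | leaf _ , _ , _ , eq = contradiction (trans (suc-injective eq) n≡1+r) λ ()
    ... | t@(node α p q) , v , t↭ , eq with em {P = kind t ≡ caterpillar}
    ...   | yes cat =
      let (t′ , d , c) = caterpillar-⊏ α p q (kind⇒caterpillar t cat)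
      in contradiction (trans (sym (cong (λ k → colourBy k t′) (caterpillar⇒class c)))
                              (colours d)) λ ()
      where
      colours : ∀ {t′} → t′ ⊏ t → colour t′ ≡ inj₂ j
      colours d = ⊏-colour {X = X} mono d v eq λ x∈t → Sample.inside S (∈-resp-↭ t↭ x∈t)
    ...   | no ≢cat =
      let (b , (t₁ , d₁ , extra-b) , (t₂ , d₂ , ≢b)) = separated t (≤-trans 5≤ (≤-reflexive (sym eq))) ≢cat
      in clash d₁ extra-b d₂ ≢b (class t₂) refl
      where
      colours : ∀ {t′} → t′ ⊏ t → colour t′ ≡ inj₂ j
      colours d = ⊏-colour {X = X} mono d v eq λ x∈t → Sample.inside S (∈-resp-↭ t↭ x∈t)
      sizes : ∀ {t′} → t′ ⊏ t → size t′ ≡ n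
      sizes d = suc-injective (trans (sym (size-⊏ d)) eq)
      clash : ∀ {t₁ t₂ b} → t₁ ⊏ t → class t₁ ≡ extra b → t₂ ⊏ t → class t₂ ≢ extra b → ∀ k → class t₂ ≡ k → ⊥
      clash {t₂ = t₂} d₁ e₁ d₂ ≢b chain e₂ =
        contradiction (trans (sym (cong (λ k → colourBy k t₂) e₂)) (colours d₂)) λ ()
      clash {t₂ = t₂} d₁ e₁ d₂ ≢b spare e₂ =
        contradiction (trans (sym (cong (λ k → colourBy k t₂) e₂)) (colours d₂)) λ ()
      clash {t₁} {t₂} d₁ e₁ d₂ ≢b (extra b′) e₂ = ≢b (trans e₂ (cong extra
        (extraColour-injective t₂ t₁ (sizes d₂) (sizes d₁) e₂ e₁ (inj₂-injective
          (trans (sym (cong (λ k → colourBy k t₂) e₂)) (trans (colours d₂)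
            (trans (sym (colours d₁)) (cong (λ k → colourBy k t₁) e₁))))))))

    -- The monochromatic set of levels

    module _ {X ξ} (mono : Monochromatic stepUp (inj₁ ξ) X) (fork-free : ForkFree (Member X))
             {Λ : Set ℓ} (S : Spine fork-free Λ) where

      open Spine S

      levels : Subset κ
      levels = record
        { Member     = λ α → ∃[ i ] level i ≡ α
        ; irrelevant = λ { (i , refl) (j , eq) → same (level-injective eq) eq }
        }
        where
        same : ∀ {i j} → j ≡ i → (eq : level j ≡ level i) → (i , refl) ≡ (j , eq)
        same refl refl = refl

      levels↔Λ : HasCardinality levels Λ
      levels↔Λ = mk↔ₛ′ (λ (_ , i , _) → i) (λ i → level i , i , refl) (λ _ → refl) λ { (_ , _ , refl) → refl }

      branch-injective : ∀ {i j} → branch i ≡ branch j → i ≡ j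
      branch-injective {i} {j} eq =
        let (z , _ , d) = beyond (i ∷ j ∷ [])
        in level-injective (D-unique (d (here refl)) (subst (λ x → D _ x z) (sym eq) (d (there (here refl)))))

      indices : ∀ l → (∀ {α} → α ∈ l → ∃[ i ] level i ≡ α) → ∃[ is ] map level is ≡ l
      indices [] _ = [] , refl
      indices (α ∷ l) l⊆ =
        let (i , eq) = l⊆ (here refl)
            (is , eqs) = indices l λ α∈l → l⊆ (there α∈l)
        in i ∷ is , cong₂ _∷_ eq eqs

      -- The r branches belonging to `T`, with a point `z` beyond them, are r + 1 points of `X`.
      -- Their tree is a caterpillar with label set `T`, so its colour is both that of `T` under `f`
      -- and ξ.
      levels-monochromatic : Monochromatic f ξ levels
      levels-monochromatic T T⊆levels = from-indices (indices list λ α∈ → T⊆levels (sound α∈))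
        where
        open Listing (listing (proj₁ T) (proj₂ T))
        from-indices : ∃[ is ] map level is ≡ list → Func.to f T ≡ ξ
        from-indices (is , eqs) = trans (sym f-labels) (inj₁-injective
          (trans (sym (cong (λ k → colourBy k t) chain-t)) (tree-colour {X = X} mono t v size-t t⊆X)))
          where
          z : A
          z = proj₁ (beyond is)
          d : ∀ {i} → i ∈ is → D (level i) (branch i) z
          d = proj₂ (proj₂ (beyond is))
          points : List A
          points = z ∷ map branch is
          is-unique : Unique is
          is-unique = Unique.map⁻ (subst Unique (sym eqs) unique)
          is-length : length is ≡ r
          is-length = trans (sym (length-map level is)) (trans (cong length eqs) length≡n)
          points-unique : Unique points
          points-unique = All.tabulate (λ y∈ z≡y → let (i , i∈ , y≡) = ∈-map⁻ branch y∈ in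
              D⇒≢ (d i∈) (sym (trans z≡y y≡)))
            ∷ Unique.map⁺ branch-injective is-unique
          built : TreeOn points
          built = treeOf points points-unique λ ()
          t : Tree κ A
          t = proj₁ built
          v : Valid t
          v = proj₁ (proj₂ built)
          t↭ : leaves t ↭ points
          t↭ = proj₂ (proj₂ built)
          size-t : size t ≡ n
          size-t = trans (sym (length-leaves t)) (trans (↭-length t↭)
            (trans (cong suc (trans (length-map branch is) is-length)) (sym n≡1+r)))
          points⊆X : ∀ {x} → x ∈ points → Member X x
          points⊆X (here refl) = proj₁ (proj₂ (beyond is))
          points⊆X (there y∈)  = let (i , _ , y≡) = ∈-map⁻ branch y∈ in subst (Member X) (sym y≡) (branch∈X i)
          t⊆X : ∀ {x} → x ∈ leaves t → Member X x
          t⊆X x∈t = points⊆X (∈-resp-↭ t↭ x∈t)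
          cat : Caterpillar t
          cat = fork-free⇒caterpillar t v λ x∈ u∈ z∈ v∈ → fork-free (t⊆X x∈) (t⊆X u∈) (t⊆X z∈) (t⊆X v∈)
          chain-t : class t ≡ chain
          chain-t = caterpillar⇒class cat
          level∈T : ∀ {i} → i ∈ is → Member (proj₁ T) (level i)
          level∈T i∈ = sound (subst (_ ∈_) eqs (∈-map⁺ level i∈))
          -- Two branches split from each other where the first of them leaves `z`.
          split∈T : ∀ {α i j} → i ∈ is → j ∈ is → D α (branch i) (branch j) → Member (proj₁ T) α
          split∈T {i = i} {j} i∈ j∈ ij with compare (level i) (level j)
          ... | tri< i<j _ _ = subst (Member (proj₁ T))
                  (D-unique (D-step (d i∈) i<j (Agree-sym (proj₁ (d j∈)))) ij) (level∈T i∈)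
          ... | tri> _ _ j<i = subst (Member (proj₁ T))
                  (D-unique (D-step (d j∈) j<i (Agree-sym (proj₁ (d i∈)))) (D-sym ij)) (level∈T j∈)
          ... | tri≈ _ i≡j _ = contradiction (cong branch (level-injective i≡j)) (D⇒≢ ij)
          labels⊆T : ∀ {α} → α ∈ labels t → Member (proj₁ T) α
          labels⊆T α∈ with labels⇒D t v α∈
          ... | x , y , x∈t , y∈t , xy with ∈-resp-↭ t↭ x∈t | ∈-resp-↭ t↭ y∈t
          ...   | here refl | here refl = contradiction xy D-irrefl
          ...   | here refl | there y∈ with ∈-map⁻ branch y∈
          ...     | i , i∈ , refl = subst (Member (proj₁ T)) (D-unique (d i∈) (D-sym xy)) (level∈T i∈)
          labels⊆T α∈ | x , y , x∈t , y∈t , xy | there x∈ | here refl with ∈-map⁻ branch x∈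
          ...     | i , i∈ , refl = subst (Member (proj₁ T)) (D-unique (d i∈) xy) (level∈T i∈)
          labels⊆T α∈ | x , y , x∈t , y∈t , xy | there x∈ | there y∈ with ∈-map⁻ branch x∈ | ∈-map⁻ branch y∈
          ...     | i , i∈ , refl | j , j∈ , refl = split∈T i∈ j∈ xy
          T⊆labels : ∀ {α} → Member (proj₁ T) α → α ∈ labels t
          T⊆labels α∈T with ∈-map⁻ level (subst (_ ∈_) (sym eqs) (complete α∈T))
          ... | i , i∈ , refl = D⇒labels t v (∈-resp-↭ (↭-sym t↭) (there (∈-map⁺ branch i∈)))
                                  (∈-resp-↭ (↭-sym t↭) (here refl)) (d i∈)
          f-labels : labelColour (labels t) ≡ Func.to f T
          f-labels = labelColour-≐ (labels-unique t v cat)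
            (suc-injective (trans (length-labels t) (trans size-t n≡1+r))) T labels⊆T T⊆labels

  stepUp-avoids : ∀ {n m} (n≡1+r : n ≡ suc r) → m ≡ suc n → (Λ : C → Set ℓ) → (∀ ξ → finite n ≤ᶜ Λ ξ) →
    ¬ (∃[ ξ ] Σ[ X ∈ Subset κ ] (Monochromatic f ξ X × HasCardinality X (Λ ξ))) →
    ¬ (∃[ c ] Σ[ X ∈ Subset A ] (Monochromatic (stepUp n≡1+r) c X ×
         HasCardinality X ([ (λ ξ → Λ ξ +ᶜ finite 1) , (λ j → finite m) ] c)))
  stepUp-avoids n≡1+r refl Λ Λ≥ none (inj₂ j , X , mono , X↔) =
    inj₂-bounded n≡1+r {X} mono record { Listing (listing X X↔) renaming (sound to inside) }
  stepUp-avoids {n} n≡1+r refl Λ Λ≥ none (inj₁ ξ , X , mono , X↔) =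
    none (ξ , levels n≡1+r {X} mono ff S , levels-monochromatic n≡1+r {X} mono ff S , levels↔Λ n≡1+r {X} mono ff S)
    where
    open Inverse X↔
    φ : Λ ξ → A
    φ i = proj₁ (from (inj₁ i))
    -- The point that `Λ ξ +ᶜ finite 1` has to spare.
    x₀ : A
    x₀ = proj₁ (from (inj₂ (lift zero)))
    from-injective : ∀ {a b} → proj₁ (from a) ≡ proj₁ (from b) → a ≡ b
    from-injective {a} {b} eq =
      trans (sym (strictlyInverseˡ a)) (trans (cong to (Σ-≡ eq)) (strictlyInverseˡ b))
      where
      Σ-≡ : ∀ {p q : ∃ (Member X)} → proj₁ p ≡ proj₁ q → p ≡ q
      Σ-≡ {x , _} refl = cong (x ,_) (Subset.irrelevant X _ _)
    φ-injective : ∀ {i j} → φ i ≡ φ j → i ≡ j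
    φ-injective eq = inj₁-injective (from-injective eq)
    φ≢x₀ : ∀ i → φ i ≢ x₀
    φ≢x₀ i eq = contradiction (from-injective eq) λ ()
    e : Fin n → Λ ξ
    e k = Injection.to (Λ≥ ξ) (lift k)
    -- `Λ≥` provides r + 1 points of `X`, and `x₀` makes them r + 2.
    sample : Sample (Member X) (suc n)
    sample = record
      { list     = x₀ ∷ tabulate (λ k → φ (e k))
      ; unique   = All.tabulate (λ y∈ x₀≡y → let (k , y≡) = ∈-tabulate⁻ y∈ in φ≢x₀ _ (sym (trans x₀≡y y≡)))
                   ∷ Unique.tabulate⁺ λ eq → cong lower (Injection.injective (Λ≥ ξ) (φ-injective eq))
      ; length≡n = cong suc (length-tabulate λ k → φ (e k))
      ; inside   = λ { (here refl) → proj₂ (from (inj₂ (lift zero)))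
                     ; (there y∈) → let (k , y≡) = ∈-tabulate⁻ y∈ in
                                    subst (Member X) (sym y≡) (proj₂ (from (inj₁ (e k)))) }
      }
    ff : ForkFree (Member X)
    ff = inj₁-fork-free n≡1+r {X} mono sample
    S : Spine ff (Λ ξ)
    S = spine ff φ φ-injective (λ i → proj₂ (from (inj₁ i))) (proj₂ (from (inj₂ (lift zero)))) φ≢x₀

theoremA1 :
    (∀ {a} → ExcludedMiddle a) →
    (∀ {a b} → Extensionality a b) →
    ∀ {ℓ} (r : ℕ) → 3 ≤ r →
    (κ : Cardinal ℓ) → finite 0 <ᶜ κ →
    (τ : Ordinal ℓ) → (0<τ : ∣ τ ∣) →
    (Λ : ∣ τ ∣ → Cardinal ℓ) → (∀ ξ → finite (r + 1) ≤ᶜ Λ ξ) →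
    κ ↛[ τ , Λ ]^ r →
    finite 2 ^ᶜ κ
      ↛[ τ ⊕ finiteOrdinal (η r) , [ (λ ξ → Λ ξ +ᶜ finite 1) , (λ j → finite (r + 2)) ] ]^ (r + 1)
theoremA1 em ext r 3≤r κ _ τ 0<τ Λ Λ≥ (f , avoids) =
  stepUp (+-comm r 1) , stepUp-avoids (+-comm r 1) (+-suc r 1) Λ Λ≥ avoids
  where open SteppingUp em ext r 3≤r κ 0<τ f
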